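{- There exist $h_0,w_0$ such that for all integers $h\ge h_0$ and $w\ge w_0$, every $(1/101)$-dense partial Sudoku of type $(h,w)$ has a fractional completion.
   Context: Let $h,w\ge 2$ be integers and $n=hw$. Rows, columns and symbols are indexed by $[n]=\{1,\dots,n\}$. For a cell $(i,j)\in[n]^2$ put $\mathrm{box}(i,j)=h\lfloor (i-1)/h\rfloor+\lfloor (j-1)/w\rfloor+1\in[n]$; the $n$ sets $\mathrm{box}^{ -1}(\ell)$ are the boxes (each an $h\times w$ subarray). A row bundle is a set of $h$ consecutive rows $\{hp+1,\dots,h(p+1)\}$ ($0\le p<w$); a column bundle is a set of $w$ consecutive columns $\{wq+1,\dots,w(q+1)\}$ ($0\le q<h$). A partial Sudoku of type $(h,w)$ is an $n\times n$ array whose cells are empty or contain a symbol of $[n]$, such that each symbol appears at most once in every row, every column and every box. Represent it by $f_P:[n]^3\to\{0,1\}$, where $f_P(i,j,k)=1$ iff symbol $k$ is in cell $(i,j)$. A fractional completion is a function $f:[n]^3\to[0,1]$ such that $f_P(i,j,k)=1$ implies $f(i,j,k)=1$, and for all $i,j,k,\ell\in[n]$: $\sum_{i'} f(i',j,k)=\sum_{j'} f(i,j',k)=\sum_{k'} f(i,j,k')=1$ and $\sum_{(i',j'):\mathrm{box}(i',j')=\ell} f(i',j',k)=1$. A partial Sudoku of type $(h,w)$ is $\epsilon$-dense if each row, each column and each box has at most $\epsilon n$ filled cells, and each symbol occurs at most $\epsilon h$ times within any row bundle and at most $\epsilon w$ times within any column bundle. -}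

module Defs where

open import Data.Nat using (ℕ; zero; suc; _+_; _*_; _∸_; _/_; _≤_; _≡ᵇ_)
open import Data.Fin using (Fin; toℕ)
open import Data.Bool using (Bool; true; false; if_then_else_; _∨_; _∧_)
open import Data.Rational using (ℚ; 0ℚ; 1ℚ) renaming (_+_ to _+ℚ_; _≤_ to _≤ℚ_)
open import Data.Product using (_×_)
open import Relation.Binary.PropositionalEquality using (_≡_)

-- Conventions: everything is 0-indexed.  Rows, columns, symbols are Fin n
-- (index t ∈ Fin n corresponds to t+1 ∈ [n] in the paper).

-- Quotient ⌊m / d⌋ for d ≥ 1 (written without an instance argument;
-- suc (d ∸ 1) = d whenever d ≥ 1).
_div_ : ℕ → ℕ → ℕ
m div d = m / suc (d ∸ 1)

-- 0-indexed box number: box(i,j) = h ⌊i/h⌋ + ⌊j/w⌋  (paper's value minus 1,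
-- with 0-indexed i, j).
box : (h w : ℕ) → ℕ → ℕ → ℕ
box h w i j = h * (i div h) + (j div w)

Σℚ : (n : ℕ) → (Fin n → ℚ) → ℚ
Σℚ zero    f = 0ℚ
Σℚ (suc n) f = f Data.Fin.zero +ℚ Σℚ n (λ i → f (Data.Fin.suc i))

Σℕ : (n : ℕ) → (Fin n → ℕ) → ℕ
Σℕ zero    f = 0
Σℕ (suc n) f = f Data.Fin.zero + Σℕ n (λ i → f (Data.Fin.suc i))

count : (n : ℕ) → (Fin n → Bool) → ℕ
count n p = Σℕ n (λ t → if p t then 1 else 0)

anyF : (n : ℕ) → (Fin n → Bool) → Bool
anyF zero    p = false
anyF (suc n) p = p Data.Fin.zero ∨ anyF n (λ i → p (Data.Fin.suc i))

-- An n×n array of (possibly empty) cells with symbols, represented by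
-- f_P : [n]^3 → {0,1}  (true ↔ 1): f_P i j k = true iff symbol k is in cell (i,j).
Array : ℕ → Set
Array n = Fin n → Fin n → Fin n → Bool

record IsPartialSudoku (h w : ℕ) (P : Array (h * w)) : Set where
  field
    cell   : ∀ i j k k' → P i j k ≡ true → P i j k' ≡ true → k ≡ k'
    row    : ∀ i j j' k → P i j k ≡ true → P i j' k ≡ true → j ≡ j'
    column : ∀ i i' j k → P i j k ≡ true → P i' j k ≡ true → i ≡ i'
    boxes  : ∀ i j i' j' k → box h w (toℕ i) (toℕ j) ≡ box h w (toℕ i') (toℕ j')
             → P i j k ≡ true → P i' j' k ≡ true → (i ≡ i' × j ≡ j')

filled : {n : ℕ} → Array n → Fin n → Fin n → Bool
filled {n} P i j = anyF n (P i j)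

-- ε-dense with ε = 1/101, where the bounds "≤ εm" are written "101·x ≤ m":
--  * each row, column and box has at most n/101 filled cells;
--  * each symbol occurs at most h/101 times within any row bundle
--    (rows i with ⌊i/h⌋ = p) and at most w/101 times within any column bundle
--    (columns j with ⌊j/w⌋ = q).
record IsDense101 (h w : ℕ) (P : Array (h * w)) : Set where
  field
    rowD    : ∀ i → 101 * count (h * w) (λ j → filled P i j) ≤ h * w
    colD    : ∀ j → 101 * count (h * w) (λ i → filled P i j) ≤ h * w
    boxD    : ∀ (ℓ : Fin (h * w)) →
              101 * Σℕ (h * w) (λ i → count (h * w) (λ j →
                       (box h w (toℕ i) (toℕ j) ≡ᵇ toℕ ℓ) ∧ filled P i j))
                ≤ h * w
    rowBundleD : ∀ (p : ℕ) → p Data.Nat.< w → ∀ k →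
              101 * Σℕ (h * w) (λ i → count (h * w) (λ j →
                       ((toℕ i) div h ≡ᵇ p) ∧ P i j k))
                ≤ h
    colBundleD : ∀ (q : ℕ) → q Data.Nat.< h → ∀ k →
              101 * Σℕ (h * w) (λ i → count (h * w) (λ j →
                       ((toℕ j) div w ≡ᵇ q) ∧ P i j k))
                ≤ w

record FractionalCompletion (h w : ℕ) (P : Array (h * w))
                            (f : Fin (h * w) → Fin (h * w) → Fin (h * w) → ℚ) : Set where
  field
    nonneg  : ∀ i j k → 0ℚ ≤ℚ f i j k
    le1     : ∀ i j k → f i j k ≤ℚ 1ℚ
    extends : ∀ i j k → P i j k ≡ true → f i j k ≡ 1ℚ
    colSum  : ∀ j k → Σℚ (h * w) (λ i' → f i' j k) ≡ 1ℚ
    rowSum  : ∀ i k → Σℚ (h * w) (λ j' → f i j' k) ≡ 1ℚ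
    cellSum : ∀ i j → Σℚ (h * w) (λ k' → f i j k') ≡ 1ℚ
    boxSum  : ∀ (ℓ : Fin (h * w)) k →
              Σℚ (h * w) (λ i' → Σℚ (h * w) (λ j' →
                 if box h w (toℕ i') (toℕ j') ≡ᵇ toℕ ℓ then f i' j' k else 0ℚ)) ≡ 1ℚ

{-# OPTIONS --safe #-}

-- Each of the four families of constraints fixes the average of f over the fibres of a map
-- defined on the n³ triples.  The four averaging operators Pₜ commute and are self-adjoint, and
-- with φ = n f_P the density hypotheses give Pₛ Pₜ φ ≤ ε for s ≠ t.
-- Call a constraint of type t unfilled where dₜ = 1 - Pₜ φ is 1, and let a = d₀ d₁ d₂ d₃ be the
-- indicator of the triples still available.  On the range of Pₜ the operator Σₛ Pₛ has an
-- explicit inverse Qₜ of norm at most 15/4, so the equation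
--   g = 1 + Σₜ Qₜ (dₜ Pₜ ((1 - a) g))
-- is a perturbation of the identity of norm at most 4 · 15/4 · 3/101 < 1/2.  Its solution g is
-- therefore nonnegative, and the claim is that f = (a g + φ) / n works.  With ψ = 1 - φ - a g one
-- finds Pₜ ψ = dₜ uₜ where Pₜ uₜ = uₜ and Σₜ uₜ = 0; hence
--   Σₜ ‖Pₜ ψ‖² = Σₜ ⟨uₜ , Pₜ ψ⟩ = ⟨Σₜ uₜ , ψ⟩ = 0.
module Submission where

open import Defs
open import Data.Bool using (Bool; true; false; if_then_else_; _∧_; T)
open import Data.Fin using (Fin; zero; suc; toℕ; fromℕ<; punchIn; combine; remQuot)
open import Data.Fin.Patterns using (0F; 1F; 2F; 3F)
open import Data.Fin.Properties
  using (toℕ<n; toℕ-fromℕ<; remQuot-combine; punchInᵢ≢i; punchIn-injective; suc-injective)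
open import Data.Integer as ℤ using (+_)
open import Data.Nat as ℕ using (ℕ; zero; suc; _≡ᵇ_)
import Data.Nat.Divisibility as ℕ
import Data.Nat.DivMod as ℕ
import Data.Nat.Properties as ℕ
open import Data.Product using (Σ; ∃; _×_; _,_; proj₁; proj₂)
open import Data.Rational
open import Data.Rational.Properties
open import Data.Rational.Solver using (module +-*-Solver)
open import Data.Sum using (inj₁; inj₂)
open import Data.Vec.Functional using (_∷_)
open import Function using (_∘_)
open import Relation.Binary.PropositionalEquality hiding (J)
open import Relation.Nullary using (yes; no; contradiction)
open import Relation.Nullary.Decidable using (from-yes)
open +-*-Solver using (solve; _:=_; _:+_; _:*_; _:-_; :-_; con)

-- The obstacle is that the constraints are linearly dependent: the four families share averages, so
-- a weight on the available triples that meets every unfilled constraint solves a singular system,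
-- whose consistency would have to be proved. The equation for `g` avoids this. It is posed on all
-- functions of triples, where it is uniquely solvable, and its correction is chosen so that the sum
-- over `t` of its `t`-averages equals the total lost mass. This balances only the sum of the four
-- defects `u t`; the orthogonality computation then separates them. The factor `d t` makes the
-- estimate possible. The density hypotheses say nothing about `P t (P t φ)`, which equals `P t φ`
-- and is 1 on filled constraints. After multiplication by `d t`, the set where `a` fails is covered
-- by the other three types alone, each contributing at most 1/101: this is the 3 in 3/101.

-- Inequalities and absolute values in ℚ

p+q≡p⇒q≡0 : ∀ {p q} → p + q ≡ p → q ≡ 0ℚ
p+q≡p⇒q≡0 {p} {q} e = begin
  q              ≡⟨ solve 2 (λ p q → q := (p :+ q) :- p) refl p q ⟩
  (p + q) - p    ≡⟨ cong (_- p) e ⟩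
  p - p          ≡⟨ +-inverseʳ p ⟩
  0ℚ             ∎
  where open ≡-Reasoning

p≤q⇒0≤q-p : ∀ {p q} → p ≤ q → 0ℚ ≤ q - p
p≤q⇒0≤q-p {p} {q} p≤q = subst (_≤ q - p) (+-inverseʳ p) (+-monoˡ-≤ (- p) p≤q)

0≤q-p⇒p≤q : ∀ {p q} → 0ℚ ≤ q - p → p ≤ q
0≤q-p⇒p≤q {p} {q} 0≤ = subst₂ _≤_ (+-identityˡ p)
  (solve 2 (λ p q → (q :- p) :+ p := q) refl p q) (+-monoˡ-≤ p 0≤)

0≤+ : ∀ {p q} → 0ℚ ≤ p → 0ℚ ≤ q → 0ℚ ≤ p + q
0≤+ = +-mono-≤

*-monoˡ : ∀ {p q r} → 0ℚ ≤ p → q ≤ r → p * q ≤ p * r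
*-monoˡ {p} 0≤p = *-monoˡ-≤-nonNeg p {{nonNegative 0≤p}}

0≤* : ∀ {p q} → 0ℚ ≤ p → 0ℚ ≤ q → 0ℚ ≤ p * q
0≤* {p} {q} 0≤p 0≤q = subst (_≤ p * q) (*-zeroʳ p) (*-monoˡ 0≤p 0≤q)

0≤p² : ∀ p → 0ℚ ≤ p * p
0≤p² p with ≤-total 0ℚ p
... | inj₁ 0≤p = 0≤* 0≤p 0≤p
... | inj₂ p≤0 = subst (0ℚ ≤_) (solve 1 (λ p → :- p :* :- p := p :* p) refl p)
                   (0≤* (neg-antimono-≤ p≤0) (neg-antimono-≤ p≤0))

p²≡0⇒p≡0 : ∀ p → p * p ≡ 0ℚ → p ≡ 0ℚ
p²≡0⇒p≡0 p p²≡0 with p ≟ 0ℚ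
... | yes p≡0 = p≡0
... | no  p≢0 = begin
  p              ≡⟨ sym (*-identityˡ p) ⟩
  1ℚ * p         ≡⟨ cong (_* p) (sym (*-inverseˡ p)) ⟩
  1/ p * p * p   ≡⟨ *-assoc (1/ p) p p ⟩
  1/ p * (p * p) ≡⟨ cong (1/ p *_) p²≡0 ⟩
  1/ p * 0ℚ      ≡⟨ *-zeroʳ (1/ p) ⟩
  0ℚ             ∎
  where
  open ≡-Reasoning
  instance _ = ≢-nonZero p≢0

p≤∣p∣ : ∀ p → p ≤ ∣ p ∣
p≤∣p∣ p with ≤-total 0ℚ p
... | inj₁ 0≤p = ≤-reflexive (sym (0≤p⇒∣p∣≡p 0≤p))
... | inj₂ p≤0 = ≤-trans p≤0 (0≤∣p∣ p)

∣p∣≤q : ∀ {p q} → p ≤ q → - p ≤ q → ∣ p ∣ ≤ q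
∣p∣≤q {p} {q} p≤q -p≤q with ∣p∣≡p∨∣p∣≡-p p
... | inj₁ e = subst (_≤ q) (sym e) p≤q
... | inj₂ e = subst (_≤ q) (sym e) -p≤q

∣+∣≤ : ∀ {p q r s} → ∣ p ∣ ≤ r → ∣ q ∣ ≤ s → ∣ p + q ∣ ≤ r + s
∣+∣≤ {p} {q} p≤r q≤s = ≤-trans (∣p+q∣≤∣p∣+∣q∣ p q) (+-mono-≤ p≤r q≤s)

∣*∣≤ : ∀ c {p r} → ∣ p ∣ ≤ r → ∣ c * p ∣ ≤ ∣ c ∣ * r
∣*∣≤ c {p} {r} p≤r = subst (_≤ ∣ c ∣ * r) (sym (∣p*q∣≡∣p∣*∣q∣ c p)) (*-monoˡ (0≤∣p∣ c) p≤r)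

-- Finite sums

Σ-cong : ∀ n {f g : Fin n → ℚ} → f ≗ g → Σℚ n f ≡ Σℚ n g
Σ-cong zero    e = refl
Σ-cong (suc n) e = cong₂ _+_ (e zero) (Σ-cong n (e ∘ suc))

Σ-+ : ∀ n (f g : Fin n → ℚ) → Σℚ n (λ i → f i + g i) ≡ Σℚ n f + Σℚ n g
Σ-+ zero    f g = refl
Σ-+ (suc n) f g = trans (cong (λ z → f zero + g zero + z) (Σ-+ n (f ∘ suc) (g ∘ suc)))
  (solve 4 (λ a b c d → (a :+ b) :+ (c :+ d) := (a :+ c) :+ (b :+ d)) refl (f zero) (g zero) (Σℚ n (f ∘ suc)) (Σℚ n (g ∘ suc)))

Σ-* : ∀ n c (f : Fin n → ℚ) → Σℚ n (λ i → c * f i) ≡ c * Σℚ n f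
Σ-* zero    c f = sym (*-zeroʳ c)
Σ-* (suc n) c f = trans (cong (λ z → c * f zero + z) (Σ-* n c (f ∘ suc)))
  (sym (*-distribˡ-+ c (f zero) (Σℚ n (f ∘ suc))))

Σ-0 : ∀ n → Σℚ n (λ _ → 0ℚ) ≡ 0ℚ
Σ-0 zero    = refl
Σ-0 (suc n) = trans (+-identityˡ (Σℚ n (λ _ → 0ℚ))) (Σ-0 n)

Σ-mono : ∀ n {f g : Fin n → ℚ} → (∀ i → f i ≤ g i) → Σℚ n f ≤ Σℚ n g
Σ-mono zero    f≤g = ≤-refl
Σ-mono (suc n) f≤g = +-mono-≤ (f≤g zero) (Σ-mono n (f≤g ∘ suc))

Σ-nonneg : ∀ n {f : Fin n → ℚ} → (∀ i → 0ℚ ≤ f i) → 0ℚ ≤ Σℚ n f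
Σ-nonneg n {f} 0≤f = subst (λ z → z ≤ Σℚ n f) (Σ-0 n) (Σ-mono n 0≤f)

Σ-swap : ∀ m n (f : Fin m → Fin n → ℚ) →
         Σℚ m (λ i → Σℚ n (f i)) ≡ Σℚ n (λ j → Σℚ m (λ i → f i j))
Σ-swap zero    n f = sym (Σ-0 n)
Σ-swap (suc m) n f = trans (cong (λ z → Σℚ n (f zero) + z) (Σ-swap m n (f ∘ suc)))
  (sym (Σ-+ n (f zero) (λ j → Σℚ m (λ i → f (suc i) j))))

term≤Σ : ∀ n {f : Fin n → ℚ} → (∀ i → 0ℚ ≤ f i) → ∀ i → f i ≤ Σℚ n f
term≤Σ (suc n) {f} 0≤f zero    = subst (λ z → z ≤ Σℚ (suc n) f) (+-identityʳ (f zero))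
  (+-monoʳ-≤ (f zero) (Σ-nonneg n (0≤f ∘ suc)))
term≤Σ (suc n) {f} 0≤f (suc i) = subst (λ z → z ≤ Σℚ (suc n) f) (+-identityˡ (f (suc i)))
  (+-mono-≤ (0≤f zero) (term≤Σ n (0≤f ∘ suc) i))

Σ≡0⇒term≡0 : ∀ n {f : Fin n → ℚ} → (∀ i → 0ℚ ≤ f i) → Σℚ n f ≡ 0ℚ → ∀ i → f i ≡ 0ℚ
Σ≡0⇒term≡0 n {f} 0≤f e i = ≤-antisym (subst (f i ≤_) e (term≤Σ n 0≤f i)) (0≤f i)

Σ-single : ∀ n {f : Fin n → ℚ} i → (∀ j → j ≢ i → f j ≡ 0ℚ) → Σℚ n f ≡ f i
Σ-single (suc n) {f} zero    f≡0 = trans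
  (cong (λ z → f zero + z) (trans (Σ-cong n (λ j → f≡0 (suc j) λ ())) (Σ-0 n)))
  (+-identityʳ (f zero))
Σ-single (suc n) {f} (suc i) f≡0 = trans
  (cong₂ _+_ (f≡0 zero λ ()) (Σ-single n i λ j j≢i → f≡0 (suc j) λ { refl → j≢i refl }))
  (+-identityˡ (f (suc i)))

-- Linear operators on spaces of rational functions

Op : Set → Set
Op X = (X → ℚ) → X → ℚ

record IsLinear {X : Set} (T : Op X) : Set where
  field
    ≗-cong : ∀ {f g} → f ≗ g → T f ≗ T g
    +-hom : ∀ f g x → T (λ y → f y + g y) x ≡ T f x + T g x
    *-hom : ∀ c f x → T (λ y → c * f y) x ≡ c * T f x

  0-hom : ∀ x → T (λ _ → 0ℚ) x ≡ 0ℚ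
  0-hom x = trans (*-hom 0ℚ (λ _ → 0ℚ) x) (*-zeroˡ (T (λ _ → 0ℚ) x))

  Σ-hom : ∀ m (F : Fin m → X → ℚ) x →
          T (λ y → Σℚ m (λ t → F t y)) x ≡ Σℚ m (λ t → T (F t) x)
  Σ-hom zero    F x = 0-hom x
  Σ-hom (suc m) F x = trans (+-hom (F zero) (λ y → Σℚ m (λ t → F (suc t) y)) x) (cong (λ z → T (F zero) x + z) (Σ-hom m (F ∘ suc) x))

open IsLinear

module _ {X : Set} where

  id-linear : IsLinear {X} (λ f → f)
  id-linear .≗-cong e = e
  id-linear .+-hom f g x = refl
  id-linear .*-hom c f x = refl

  ∘-linear : ∀ {A B : Op X} → IsLinear A → IsLinear B → IsLinear (λ f → A (B f))
  ∘-linear {A} {B} a b .≗-cong e = ≗-cong a (≗-cong b e)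
  ∘-linear {A} {B} a b .+-hom f g x = trans (≗-cong a (+-hom b f g) x) (+-hom a (B f) (B g) x)
  ∘-linear {A} {B} a b .*-hom c f x = trans (≗-cong a (*-hom b c f) x) (*-hom a c (B f) x)

  +-linear : ∀ {A B : Op X} → IsLinear A → IsLinear B → IsLinear (λ f x → A f x + B f x)
  +-linear {A} {B} a b .≗-cong e x = cong₂ _+_ (≗-cong a e x) (≗-cong b e x)
  +-linear {A} {B} a b .+-hom f g x = trans (cong₂ _+_ (+-hom a f g x) (+-hom b f g x))
    (solve 4 (λ a b c d → (a :+ b) :+ (c :+ d) := (a :+ c) :+ (b :+ d)) refl (A f x) (A g x) (B f x) (B g x))
  +-linear {A} {B} a b .*-hom c f x = trans (cong₂ _+_ (*-hom a c f x) (*-hom b c f x))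
    (sym (*-distribˡ-+ c (A f x) (B f x)))

  *-linear : ∀ (d : X → ℚ) {A : Op X} → IsLinear A → IsLinear (λ f x → d x * A f x)
  *-linear d {A} a .≗-cong e x = cong (d x *_) (≗-cong a e x)
  *-linear d {A} a .+-hom f g x = trans (cong (d x *_) (+-hom a f g x)) (*-distribˡ-+ (d x) (A f x) (A g x))
  *-linear d {A} a .*-hom c f x = trans (cong (d x *_) (*-hom a c f x))
    (solve 3 (λ d c y → d :* (c :* y) := c :* (d :* y)) refl (d x) c (A f x))

  Σ-linear : ∀ m {A : Fin m → Op X} → (∀ t → IsLinear (A t)) →
             IsLinear (λ f x → Σℚ m (λ t → A t f x))
  Σ-linear m {A} a .≗-cong e x = Σ-cong m (λ t → ≗-cong (a t) e x)
  Σ-linear m {A} a .+-hom f g x = trans (Σ-cong m (λ t → +-hom (a t) f g x)) (Σ-+ m (λ t → A t f x) (λ t → A t g x))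
  Σ-linear m {A} a .*-hom c f x = trans (Σ-cong m (λ t → *-hom (a t) c f x)) (Σ-* m c (λ t → A t f x))

-- Contractions

infix 4 ‖_‖≤_

‖_‖≤_ : {X : Set} → (X → ℚ) → ℚ → Set
‖ f ‖≤ m = ∀ x → ∣ f x ∣ ≤ m

Bounded : {X : Set} → ℚ → Op X → Set
Bounded κ T = ∀ {m f} → 0ℚ ≤ m → ‖ f ‖≤ m → ‖ T f ‖≤ κ * m

∷-cong : ∀ {n p q} {f g : Fin n → ℚ} → p ≡ q → f ≗ g → (p ∷ f) ≗ (q ∷ g)
∷-cong p≡q f≗g zero    = p≡q
∷-cong p≡q f≗g (suc x) = f≗g x

abstract
  reciprocal : ∀ {p} → p < 1ℚ → ∃ λ r → (1ℚ - p) * r ≡ 1ℚ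
  reciprocal {p} p<1 = 1/ (1ℚ - p) , *-inverseʳ (1ℚ - p)
    where
    instance
      1-p≢0 : NonZero (1ℚ - p)
      1-p≢0 = ≢-nonZero {1ℚ - p} λ e → <-irrefl (trans
        (solve 1 (λ p → p := con 1ℚ :- (con 1ℚ :- p)) refl p)
        (cong (λ z → 1ℚ - z) {1ℚ - p} {0ℚ} e)) p<1

-- If `s` exceeded `m`, then `s ≤ κ * s` with `κ < 1` would force `s ≤ 0 ≤ m`. This bounds a
-- coordinate that is determined only implicitly, by an equation containing itself.
≤κ*-trap : ∀ {κ m s} → κ < 1ℚ → 0ℚ ≤ m → (m ≤ s → s ≤ κ * s) → s ≤ m
≤κ*-trap {κ} {m} {s} κ<1 0≤m s≤κs with ≤-total s m
... | inj₁ s≤m = s≤m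
... | inj₂ m≤s = ≤-trans (≮⇒≥ λ 0<s → <-irrefl refl (begin-strict
    s        ≤⟨ s≤κs m≤s ⟩
    κ * s    <⟨ *-monoˡ-<-pos s {{positive 0<s}} κ<1 ⟩
    1ℚ * s   ≡⟨ *-identityˡ s ⟩
    s        ∎)) 0≤m
  where open ≤-Reasoning

-- Gaussian elimination, by induction on the number of coordinates. The zeroth equation is solved
-- for the zeroth coordinate and substituted into the others; the induction goes through because the
-- reduced operator `T′` inherits linearity and the same bound `κ`.
fixed-point-Fin : ∀ {κ} → κ < 1ℚ → ∀ n {T : Op (Fin n)} → IsLinear T → Bounded κ T →
                  ∀ (b : Fin n → ℚ) → ∃ λ (g : Fin n → ℚ) → ∀ x → g x ≡ b x + T g x
fixed-point-Fin κ<1 zero    lin bd b = b , λ ()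
fixed-point-Fin {κ} κ<1 (suc n) {T} lin bd b = g , g-fixed
  where
  𝟘 : Fin n → ℚ
  𝟘 _ = 0ℚ

  -- The zeroth diagonal entry of `T`; the pivot is `1ℚ - τ`, positive because `τ ≤ κ < 1ℚ`, and `ρ`
  -- is its reciprocal.
  τ : ℚ
  τ = T (1ℚ ∷ 𝟘) zero

  τ<1 : τ < 1ℚ
  τ<1 = ≤-<-trans (≤-trans (p≤∣p∣ τ) (subst (∣ τ ∣ ≤_) (*-identityʳ κ) (bd (<⇒≤ (positive⁻¹ 1ℚ)) e₀≤1 zero))) κ<1
    where
    e₀≤1 : ‖ 1ℚ ∷ 𝟘 ‖≤ 1ℚ
    e₀≤1 zero    = ≤-refl
    e₀≤1 (suc x) = <⇒≤ (positive⁻¹ 1ℚ)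

  ρ∃ = reciprocal τ<1

  ρ : ℚ
  ρ = proj₁ ρ∃

  eliminate : ∀ p → ρ * p ≡ p + ρ * p * τ
  eliminate p = begin
    ρ * p                            ≡⟨ solve 3 (λ r p t → r :* p := (con 1ℚ :- t) :* r :* p :- p :+ (p :+ r :* p :* t)) refl ρ p τ ⟩
    (1ℚ - τ) * ρ * p - p + (p + ρ * p * τ) ≡⟨ cong (λ z → z * p - p + (p + ρ * p * τ)) (proj₂ ρ∃) ⟩
    1ℚ * p - p + (p + ρ * p * τ)     ≡⟨ solve 2 (λ p z → con 1ℚ :* p :- p :+ z := z) refl p (p + ρ * p * τ) ⟩
    p + ρ * p * τ                    ∎
    where open ≡-Reasoning

  T-∷ : ∀ t f x → T (t ∷ f) x ≡ t * T (1ℚ ∷ 𝟘) x + T (0ℚ ∷ f) x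
  T-∷ t f x = begin
    T (t ∷ f) x                                        ≡⟨ ≗-cong lin split x ⟩
    T (λ y → t * (1ℚ ∷ 𝟘) y + (0ℚ ∷ f) y) x            ≡⟨ +-hom lin (λ y → t * (1ℚ ∷ 𝟘) y) (0ℚ ∷ f) x ⟩
    T (λ y → t * (1ℚ ∷ 𝟘) y) x + T (0ℚ ∷ f) x          ≡⟨ cong (_+ T (0ℚ ∷ f) x) (*-hom lin t (1ℚ ∷ 𝟘) x) ⟩
    t * T (1ℚ ∷ 𝟘) x + T (0ℚ ∷ f) x                    ∎
    where
    open ≡-Reasoning
    split : (t ∷ f) ≗ (λ y → t * (1ℚ ∷ 𝟘) y + (0ℚ ∷ f) y)
    split zero    = solve 1 (λ t → t := t :* con 1ℚ :+ con 0ℚ) refl t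
    split (suc y) = solve 2 (λ t z → z := t :* con 0ℚ :+ z) refl t (f y)

  -- The value that the homogeneous zeroth equation `t ≡ T (t ∷ f) zero` forces on the zeroth
  -- coordinate when the remaining ones are `f`.
  s : (Fin n → ℚ) → ℚ
  s f = ρ * T (0ℚ ∷ f) zero

  s-fixed : ∀ f → s f ≡ T (s f ∷ f) zero
  s-fixed f = begin
    s f                         ≡⟨ eliminate (T (0ℚ ∷ f) zero) ⟩
    T (0ℚ ∷ f) zero + s f * τ   ≡⟨ +-comm (T (0ℚ ∷ f) zero) (s f * τ) ⟩
    s f * τ + T (0ℚ ∷ f) zero   ≡⟨ sym (T-∷ (s f) f zero) ⟩
    T (s f ∷ f) zero            ∎
    where open ≡-Reasoning

  -- `id - T′` is the Schur complement of the pivot in `id - T`.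
  T′ : Op (Fin n)
  T′ f x = T (s f ∷ f) (suc x)

  s-cong : ∀ {f g} → f ≗ g → s f ≡ s g
  s-cong e = cong (ρ *_) (≗-cong lin (∷-cong refl e) zero)

  s-+ : ∀ f g → s (λ x → f x + g x) ≡ s f + s g
  s-+ f g = trans (cong (ρ *_) (trans (≗-cong lin (λ { zero → refl ; (suc x) → refl }) zero) (+-hom lin (0ℚ ∷ f) (0ℚ ∷ g) zero)))
    (*-distribˡ-+ ρ (T (0ℚ ∷ f) zero) (T (0ℚ ∷ g) zero))

  s-* : ∀ c f → s (λ x → c * f x) ≡ c * s f
  s-* c f = trans (cong (ρ *_) (trans (≗-cong lin (λ { zero → sym (*-zeroʳ c) ; (suc x) → refl }) zero) (*-hom lin c (0ℚ ∷ f) zero)))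
    (solve 3 (λ r c z → r :* (c :* z) := c :* (r :* z)) refl ρ c (T (0ℚ ∷ f) zero))

  lin′ : IsLinear T′
  lin′ .≗-cong e x = ≗-cong lin (∷-cong (s-cong e) e) (suc x)
  lin′ .+-hom f g x = trans (≗-cong lin (λ { zero → s-+ f g ; (suc y) → refl }) (suc x)) (+-hom lin (s f ∷ f) (s g ∷ g) (suc x))
  lin′ .*-hom c f x = trans (≗-cong lin (λ { zero → s-* c f ; (suc y) → refl }) (suc x)) (*-hom lin c (s f ∷ f) (suc x))

  -- If |s f| exceeded m ≥ ‖f‖ then s f would be the largest entry of s f ∷ f,
  -- and s f = T (s f ∷ f) 0 would contradict contractivity.
  s-bounded : ∀ {m f} → 0ℚ ≤ m → ‖ f ‖≤ m → ∣ s f ∣ ≤ m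
  s-bounded {m} {f} 0≤m f≤m = ≤κ*-trap κ<1 0≤m λ m≤s →
    subst (λ z → ∣ z ∣ ≤ κ * ∣ s f ∣) (sym (s-fixed f))
      (bd (0≤∣p∣ (s f)) (λ { zero → ≤-refl ; (suc x) → ≤-trans (f≤m x) m≤s }) zero)

  bd′ : Bounded κ T′
  bd′ 0≤m f≤m x = bd 0≤m (λ { zero → s-bounded 0≤m f≤m ; (suc y) → f≤m y }) (suc x)

  -- The zeroth coordinate splits as `b₀ + s g′`: `b₀` answers the inhomogeneous term, `s g′` the
  -- other coordinates. The influence of `b₀` on the remaining equations is moved into their
  -- right-hand side.
  b₀ : ℚ
  b₀ = ρ * b zero

  rest = fixed-point-Fin κ<1 n lin′ bd′ (λ x → b (suc x) + T (b₀ ∷ 𝟘) (suc x))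

  g′ = proj₁ rest

  g : Fin (suc n) → ℚ
  g = (b₀ + s g′) ∷ g′

  T-g : ∀ x → T g x ≡ T (b₀ ∷ 𝟘) x + T (s g′ ∷ g′) x
  T-g x = trans (≗-cong lin (λ { zero → refl ; (suc y) → sym (+-identityˡ (g′ y)) }) x) (+-hom lin (b₀ ∷ 𝟘) (s g′ ∷ g′) x)

  g-fixed : ∀ x → g x ≡ b x + T g x
  g-fixed zero = begin
    b₀ + s g′                                      ≡⟨ cong₂ _+_ (eliminate (b zero)) (s-fixed g′) ⟩
    (b zero + b₀ * τ) + T (s g′ ∷ g′) zero         ≡⟨ cong (λ z → (b zero + z) + T (s g′ ∷ g′) zero) (sym b₀-τ) ⟩
    (b zero + T (b₀ ∷ 𝟘) zero) + T (s g′ ∷ g′) zero ≡⟨ +-assoc (b zero) (T (b₀ ∷ 𝟘) zero) (T (s g′ ∷ g′) zero) ⟩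
    b zero + (T (b₀ ∷ 𝟘) zero + T (s g′ ∷ g′) zero) ≡⟨ cong (λ z → b zero + z) (sym (T-g zero)) ⟩
    b zero + T g zero ∎
    where
    open ≡-Reasoning
    b₀-τ : T (b₀ ∷ 𝟘) zero ≡ b₀ * τ
    b₀-τ = trans (≗-cong lin (λ { zero → sym (*-identityʳ b₀) ; (suc y) → sym (*-zeroʳ b₀) }) zero) (*-hom lin b₀ (1ℚ ∷ 𝟘) zero)
  g-fixed (suc x) = begin
    g′ x                                                     ≡⟨ proj₂ rest x ⟩
    (b (suc x) + T (b₀ ∷ 𝟘) (suc x)) + T (s g′ ∷ g′) (suc x) ≡⟨ +-assoc (b (suc x)) (T (b₀ ∷ 𝟘) (suc x)) (T (s g′ ∷ g′) (suc x)) ⟩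
    b (suc x) + (T (b₀ ∷ 𝟘) (suc x) + T (s g′ ∷ g′) (suc x)) ≡⟨ cong (λ z → b (suc x) + z) (sym (T-g (suc x))) ⟩
    b (suc x) + T g (suc x)                                  ∎
    where open ≡-Reasoning

-- The maximum norm together with its minimality among nonnegative bounds. Minimality lets a bound
-- on a fixed point that mentions its own norm be turned into an inequality for that norm.
norm-Fin : ∀ n (f : Fin n → ℚ) → ∃ λ m → 0ℚ ≤ m × ‖ f ‖≤ m × (∀ {c} → 0ℚ ≤ c → ‖ f ‖≤ c → m ≤ c)
norm-Fin zero    f = 0ℚ , ≤-refl , (λ ()) , λ 0≤c _ → 0≤c
norm-Fin (suc n) f with norm-Fin n (f ∘ suc)
... | m , 0≤m , f≤m , least = ∣ f zero ∣ ⊔ m , ≤-trans 0≤m (p≤q⊔p ∣ f zero ∣ m)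
    , (λ { zero → p≤p⊔q ∣ f zero ∣ m ; (suc x) → ≤-trans (f≤m x) (p≤q⊔p ∣ f zero ∣ m) })
    , λ 0≤c f≤c → ⊔-lub (f≤c zero) (least 0≤c (f≤c ∘ suc))

-- Presents `X` as a retract of `Fin size`; functions are transported by precomposition with `index`
-- and `at`.
record Enumeration (X : Set) : Set where
  field
    size   : ℕ
    index  : X → Fin size
    at     : Fin size → X
    at-index : ∀ x → at (index x) ≡ x

module _ {X : Set} (enum : Enumeration X) where
  open Enumeration enum

  fixed-point : ∀ {κ} → κ < 1ℚ → {T : Op X} → IsLinear T → Bounded κ T →
                ∀ (b : X → ℚ) → ∃ λ (g : X → ℚ) → ∀ x → g x ≡ b x + T g x
  fixed-point {κ} κ<1 {T} lin bd b = g , λ x →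
    trans (proj₂ sol (index x)) (cong₂ (λ y z → b y + T g z) (at-index x) (at-index x))
    where
    sol = fixed-point-Fin κ<1 size {λ f i → T (f ∘ index) (at i)}
      (record { ≗-cong = λ e i → ≗-cong lin (e ∘ index) (at i)
              ; +-hom = λ f g i → +-hom lin (f ∘ index) (g ∘ index) (at i)
              ; *-hom = λ c f i → *-hom lin c (f ∘ index) (at i) })
      (λ 0≤m f≤m i → bd 0≤m (f≤m ∘ index) (at i))
      (b ∘ at)
    g = proj₁ sol ∘ index

  norm : ∀ (f : X → ℚ) → ∃ λ m → 0ℚ ≤ m × ‖ f ‖≤ m × (∀ {c} → 0ℚ ≤ c → ‖ f ‖≤ c → m ≤ c)
  norm f with norm-Fin size (f ∘ at)
  ... | m , 0≤m , f≤m , least = m , 0≤m , (λ x → subst (λ y → ∣ f y ∣ ≤ m) (at-index x) (f≤m (index x)))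
      , λ 0≤c f≤c → least 0≤c (f≤c ∘ at)

  -- The norm `m` of the solution satisfies `m ≤ 1ℚ + ½ * m`, hence `½ * m ≤ 1ℚ`. So `T g` is at
  -- least `- 1ℚ` everywhere and `g`, being `1ℚ + T g`, is nonnegative. The factor ½ is the largest
  -- for which this argument works: a factor κ gives the bound κ/(1-κ) on `T g`.
  nonneg-fixed-point : {T : Op X} → IsLinear T → Bounded ½ T →
                       ∃ λ g → (∀ x → g x ≡ 1ℚ + T g x) × (∀ x → 0ℚ ≤ g x)
  nonneg-fixed-point {T} lin bd with fixed-point {½} (*<* (ℤ.+<+ (ℕ.s≤s (ℕ.s≤s ℕ.z≤n)))) lin bd (λ _ → 1ℚ)
  ... | g , fixed with norm g
  ... | m , 0≤m , g≤m , least = g , fixed , λ x → 0≤g x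
    where
    open ≤-Reasoning

    Tg≤ : ‖ T g ‖≤ ½ * m
    Tg≤ = bd 0≤m g≤m

    0≤½m : 0ℚ ≤ ½ * m
    0≤½m = 0≤* (nonNegative⁻¹ ½) 0≤m

    m≤ : m ≤ 1ℚ + ½ * m
    m≤ = least (0≤+ (nonNegative⁻¹ 1ℚ) 0≤½m)
      (λ x → subst (λ z → ∣ z ∣ ≤ 1ℚ + ½ * m) (sym (fixed x)) (∣+∣≤ {1ℚ} ≤-refl (Tg≤ x)))

    ½m≤1 : ½ * m ≤ 1ℚ
    ½m≤1 = begin
      ½ * m                  ≡⟨ solve 1 (λ m → con ½ :* m := m :+ :- (con ½ :* m)) refl m ⟩
      m + - (½ * m)          ≤⟨ +-monoˡ-≤ (- (½ * m)) m≤ ⟩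
      1ℚ + ½ * m + - (½ * m) ≡⟨ solve 1 (λ z → con 1ℚ :+ z :+ :- z := con 1ℚ) refl (½ * m) ⟩
      1ℚ                     ∎

    0≤g : ∀ x → 0ℚ ≤ g x
    0≤g x = begin
      0ℚ                     ≤⟨ p≤q⇒0≤q-p -Tg≤1 ⟩
      1ℚ - (- T g x)         ≡⟨ solve 1 (λ z → con 1ℚ :- (:- z) := con 1ℚ :+ z) refl (T g x) ⟩
      1ℚ + T g x             ≡⟨ sym (fixed x) ⟩
      g x                    ∎
      where
      -Tg≤1 : - T g x ≤ 1ℚ
      -Tg≤1 = ≤-trans (p≤∣p∣ (- T g x)) (subst (_≤ 1ℚ) (sym (∣-p∣≡∣p∣ (T g x))) (≤-trans (Tg≤ x) ½m≤1))

-- Singling out one of four constraint types; averaging operators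

∣Σ∣≤ : ∀ n {f : Fin n → ℚ} {k} → (∀ i → ∣ f i ∣ ≤ k) → ∣ Σℚ n f ∣ ≤ Σℚ n (λ _ → k)
∣Σ∣≤ zero    f≤k = ≤-refl
∣Σ∣≤ (suc n) {f} f≤k = ∣+∣≤ {f zero} (f≤k zero) (∣Σ∣≤ n (f≤k ∘ suc))

Σ-punchIn : ∀ (F : Fin 4 → ℚ) t →
            Σℚ 4 F ≡ F t + (F (punchIn t 0F) + (F (punchIn t 1F) + F (punchIn t 2F)))
Σ-punchIn F 0F = solve 4 (λ a b c d → a :+ (b :+ (c :+ (d :+ con 0ℚ))) := a :+ (b :+ (c :+ d))) refl (F 0F) (F 1F) (F 2F) (F 3F)
Σ-punchIn F 1F = solve 4 (λ a b c d → a :+ (b :+ (c :+ (d :+ con 0ℚ))) := b :+ (a :+ (c :+ d))) refl (F 0F) (F 1F) (F 2F) (F 3F)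
Σ-punchIn F 2F = solve 4 (λ a b c d → a :+ (b :+ (c :+ (d :+ con 0ℚ))) := c :+ (a :+ (b :+ d))) refl (F 0F) (F 1F) (F 2F) (F 3F)
Σ-punchIn F 3F = solve 4 (λ a b c d → a :+ (b :+ (c :+ (d :+ con 0ℚ))) := d :+ (a :+ (b :+ c))) refl (F 0F) (F 1F) (F 2F) (F 3F)

Π₄ : (Fin 4 → ℚ) → ℚ
Π₄ F = F 0F * (F 1F * (F 2F * F 3F))

Π-punchIn : ∀ (F : Fin 4 → ℚ) t →
            Π₄ F ≡ F t * (F (punchIn t 0F) * (F (punchIn t 1F) * F (punchIn t 2F)))
Π-punchIn F 0F = refl
Π-punchIn F 1F = solve 4 (λ a b c d → a :* (b :* (c :* d)) := b :* (a :* (c :* d))) refl (F 0F) (F 1F) (F 2F) (F 3F)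
Π-punchIn F 2F = solve 4 (λ a b c d → a :* (b :* (c :* d)) := c :* (a :* (b :* d))) refl (F 0F) (F 1F) (F 2F) (F 3F)
Π-punchIn F 3F = solve 4 (λ a b c d → a :* (b :* (c :* d)) := d :* (a :* (b :* c))) refl (F 0F) (F 1F) (F 2F) (F 3F)

-- `S` stands for the sum over all points of `X`. Definiteness is what turns a vanishing sum of
-- squares into pointwise vanishing.
record IsDefinite {X : Set} (S : (X → ℚ) → ℚ) : Set where
  field
    S-cong : ∀ {f g} → f ≗ g → S f ≡ S g
    S-+ : ∀ f g → S (λ x → f x + g x) ≡ S f + S g
    S-definite : ∀ {f} → (∀ x → 0ℚ ≤ f x) → S f ≡ 0ℚ → ∀ x → f x ≡ 0ℚ

  S-0 : S (λ _ → 0ℚ) ≡ 0ℚ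
  S-0 = p+q≡p⇒q≡0 {S (λ _ → 0ℚ)} {S (λ _ → 0ℚ)} (sym (S-+ (λ _ → 0ℚ) (λ _ → 0ℚ)))

  S-Σ : ∀ m (F : Fin m → X → ℚ) → S (λ x → Σℚ m (λ t → F t x)) ≡ Σℚ m (λ t → S (F t))
  S-Σ zero    F = S-0
  S-Σ (suc m) F = trans (S-+ (F zero) (λ x → Σℚ m (λ t → F (suc t) x))) (cong (λ z → S (F zero) + z) (S-Σ m (F ∘ suc)))

-- Conditional expectations with respect to the uniform measure.
record Averaging {X : Set} (S : (X → ℚ) → ℚ) (P : Op X) : Set where
  field
    linear : IsLinear P
    mono : ∀ {f g} → (∀ x → f x ≤ g x) → ∀ x → P f x ≤ P g x
    const : ∀ c x → P (λ _ → c) x ≡ c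
    pull-out : ∀ f g x → P (λ y → P f y * g y) x ≡ P f x * P g x
    self-adjoint : ∀ f g → S (λ x → P f x * g x) ≡ S (λ x → f x * P g x)

  idem : ∀ f x → P (P f) x ≡ P f x
  idem f x = begin
    P (P f) x                      ≡⟨ ≗-cong linear (λ y → sym (*-identityʳ (P f y))) x ⟩
    P (λ y → P f y * 1ℚ) x         ≡⟨ pull-out f (λ _ → 1ℚ) x ⟩
    P f x * P (λ _ → 1ℚ) x         ≡⟨ cong (P f x *_) (const 1ℚ x) ⟩
    P f x * 1ℚ                     ≡⟨ *-identityʳ (P f x) ⟩
    P f x                          ∎
    where open ≡-Reasoning

  neg-hom : ∀ f x → P (λ y → - f y) x ≡ - P f x
  neg-hom f x = begin
    P (λ y → - f y) x       ≡⟨ ≗-cong linear (λ y → solve 1 (λ z → :- z := con (- 1ℚ) :* z) refl (f y)) x ⟩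
    P (λ y → - 1ℚ * f y) x  ≡⟨ *-hom linear (- 1ℚ) f x ⟩
    - 1ℚ * P f x            ≡⟨ solve 1 (λ z → con (- 1ℚ) :* z := :- z) refl (P f x) ⟩
    - P f x                 ∎
    where open ≡-Reasoning

  ∣∣-mono : ∀ {f k} → (∀ x → ∣ f x ∣ ≤ k x) → ∀ x → ∣ P f x ∣ ≤ P k x
  ∣∣-mono {f} {k} f≤k x = ∣p∣≤q
    (mono (λ y → ≤-trans (p≤∣p∣ (f y)) (f≤k y)) x)
    (subst (λ z → z ≤ P k x) (neg-hom f x)
      (mono (λ y → ≤-trans (p≤∣p∣ (- f y)) (subst (λ z → z ≤ k y) (sym (∣-p∣≡∣p∣ (f y))) (f≤k y))) x))

  nonexpansive : ∀ {f m} → ‖ f ‖≤ m → ‖ P f ‖≤ m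
  nonexpansive {f} {m} f≤m x = subst (∣ P f x ∣ ≤_) (const m x) (∣∣-mono {f} {λ _ → m} f≤m x)

open Averaging

-- If v is fixed by an averaging operator Pₛ that commutes with A, B and C, then
-- Q A B C v = (Pₛ + A + B + C)⁻¹ v: the coefficients are those for which
-- 1 - e₁/2 + e₂/3 - e₃/4 = 1/(1 + r) when r of the three eigenvalues are 1 and the others 0.

q₁ q₂ q₃ : ℚ
q₁ = - ½
q₂ = + 1 / 3
q₃ = - (+ 1 / 4)

-- The eight slots hold the values at one point of `v` and of its images under the products of
-- distinct operators among A, B, C. Because these are commuting idempotents, applying one of them
-- only merges slots, so identities between operators become linear identities in eight rational
-- variables.
comb₈ : (v a b c ab ac bc abc : ℚ) → ℚ
comb₈ v a b c ab ac bc abc = ((v + q₁ * (a + b + c)) + q₂ * (ab + ac + bc)) + q₃ * abc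

comb₈-cong : ∀ {v v′ a a′ b b′ c c′ ab ab′ ac ac′ bc bc′ abc abc′} →
  v ≡ v′ → a ≡ a′ → b ≡ b′ → c ≡ c′ → ab ≡ ab′ → ac ≡ ac′ → bc ≡ bc′ → abc ≡ abc′ →
  comb₈ v a b c ab ac bc abc ≡ comb₈ v′ a′ b′ c′ ab′ ac′ bc′ abc′
comb₈-cong refl refl refl refl refl refl refl refl = refl

module _ {X : Set} where

  Q : (A B C : Op X) → Op X
  Q A B C v x = comb₈ (v x) (A v x) (B v x) (C v x) (A (B v) x) (A (C v) x) (B (C v) x) (A (B (C v)) x)

  module _ {L : Op X} (lin : IsLinear L) where

    axpy-hom : ∀ f c g x → L (λ y → f y + c * g y) x ≡ L f x + c * L g x
    axpy-hom f c g x = trans (+-hom lin f (λ y → c * g y) x) (cong (λ z → L f x + z) (*-hom lin c g x))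

    +₃-hom : ∀ f g h x → L (λ y → f y + g y + h y) x ≡ L f x + L g x + L h x
    +₃-hom f g h x = trans (+-hom lin (λ y → f y + g y) h x) (cong (λ z → z + L h x) (+-hom lin f g x))

    comb₈-hom : ∀ v a b c ab ac bc abc x →
      L (λ y → comb₈ (v y) (a y) (b y) (c y) (ab y) (ac y) (bc y) (abc y)) x ≡
      comb₈ (L v x) (L a x) (L b x) (L c x) (L ab x) (L ac x) (L bc x) (L abc x)
    comb₈-hom v a b c ab ac bc abc x =
      trans (axpy-hom (λ y → (v y + q₁ * (a y + b y + c y)) + q₂ * (ab y + ac y + bc y)) q₃ abc x)
        (cong (λ z → z + q₃ * L abc x)
          (trans (axpy-hom (λ y → v y + q₁ * (a y + b y + c y)) q₂ (λ y → ab y + ac y + bc y) x)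
            (cong₂ (λ z z′ → z + q₂ * z′)
              (trans (axpy-hom v q₁ (λ y → a y + b y + c y) x)
                (cong (λ z → L v x + q₁ * z) (+₃-hom a b c x)))
              (+₃-hom ab ac bc x))))

  Q-linear : ∀ {A B C} → IsLinear A → IsLinear B → IsLinear C → IsLinear (Q A B C)
  Q-linear a b c =
    +-linear (+-linear (+-linear id-linear
      (*-linear (λ _ → q₁) (+-linear (+-linear a b) c)))
      (*-linear (λ _ → q₂) (+-linear (+-linear (∘-linear a b) (∘-linear a c)) (∘-linear b c))))
      (*-linear (λ _ → q₃) (∘-linear a (∘-linear b c)))

  module _ {S : (X → ℚ) → ℚ} {A B C : Op X}
           (avA : Averaging S A) (avB : Averaging S B) (avC : Averaging S C) where

    -- Triangle inequality with every product of the operators nonexpansive: the constant is the sum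
    -- of the absolute coefficients, 1 + 3/2 + 3/3 + 1/4.
    Q-bound : ∀ {v m} → ‖ v ‖≤ m → ‖ Q A B C v ‖≤ (+ 15 / 4) * m
    Q-bound {v} {m} v≤m x = subst (λ z → ∣ Q A B C v x ∣ ≤ z)
      (solve 1 (λ m → ((m :+ con ½ :* (m :+ m :+ m)) :+ con (+ 1 / 3) :* (m :+ m :+ m)) :+ con (+ 1 / 4) :* m
                      := con (+ 15 / 4) :* m) refl m)
      (∣+∣≤ {(v x + q₁ * (A v x + B v x + C v x)) + q₂ * (A (B v) x + A (C v) x + B (C v) x)}
        (∣+∣≤ {v x + q₁ * (A v x + B v x + C v x)}
          (∣+∣≤ {v x} (v≤m x) (∣*∣≤ q₁ (≤₃ (av v≤m x) (bv v≤m x) (cv v≤m x))))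
          (∣*∣≤ q₂ (≤₃ (av (bv v≤m) x) (av (cv v≤m) x) (bv (cv v≤m) x))))
        (∣*∣≤ q₃ (av (bv (cv v≤m)) x)))
      where
      av : ∀ {f} → ‖ f ‖≤ m → ‖ A f ‖≤ m
      av = nonexpansive avA
      bv : ∀ {f} → ‖ f ‖≤ m → ‖ B f ‖≤ m
      bv = nonexpansive avB
      cv : ∀ {f} → ‖ f ‖≤ m → ‖ C f ‖≤ m
      cv = nonexpansive avC
      ≤₃ : ∀ {p q r} → ∣ p ∣ ≤ m → ∣ q ∣ ≤ m → ∣ r ∣ ≤ m → ∣ p + q + r ∣ ≤ m + m + m
      ≤₃ {p} {q} {r} p≤ q≤ r≤ = ∣+∣≤ {p + q} (∣+∣≤ {p} p≤ q≤) r≤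

    module _ (AB : ∀ f → B (A f) ≗ A (B f)) (AC : ∀ f → C (A f) ≗ A (C f)) (BC : ∀ f → C (B f) ≗ B (C f)) where

      -- `P` fixes `v` and commutes with A, B and C, so it fixes all eight slots; A, B and C merge
      -- slots by idempotence. The sum of the four resulting rows then collapses to `v`.
      Q-inverse : ∀ {P : Op X} → IsLinear P →
        (∀ f → P (A f) ≗ A (P f)) → (∀ f → P (B f) ≗ B (P f)) → (∀ f → P (C f) ≗ C (P f)) →
        ∀ {v} → P v ≗ v → ∀ x →
        P (Q A B C v) x + (A (Q A B C v) x + (B (Q A B C v) x + C (Q A B C v) x)) ≡ v x
      Q-inverse {P} linP PA PB PC {v} Pv x = trans
        (cong₂ _+_ P-Q (cong₂ _+_ A-Q (cong₂ _+_ B-Q C-Q)))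
        (solve 8 (λ v a b c ab ac bc abc →
            comb v a b c ab ac bc abc :+ (comb a a ab ac ab ac abc abc :+
            (comb b ab b bc ab abc bc abc :+ comb c ac bc c abc ac bc abc)) := v)
          refl (v x) (A v x) (B v x) (C v x) (A (B v) x) (A (C v) x) (B (C v) x) (A (B (C v)) x))
        where
        comb = λ v a b c ab ac bc abc →
          ((v :+ con q₁ :* (a :+ b :+ c)) :+ con q₂ :* (ab :+ ac :+ bc)) :+ con q₃ :* abc

        linA = linear avA
        linB = linear avB
        linC = linear avC

        expand : ∀ {L} → IsLinear L → L (Q A B C v) x ≡ comb₈ (L v x) (L (A v) x) (L (B v) x) (L (C v) x)
                   (L (A (B v)) x) (L (A (C v)) x) (L (B (C v)) x) (L (A (B (C v))) x)
        expand lin = comb₈-hom lin v (A v) (B v) (C v) (A (B v)) (A (C v)) (B (C v)) (A (B (C v))) x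

        PAw : ∀ {w} → P w ≗ w → P (A w) ≗ A w
        PAw {w} e y = trans (PA w y) (≗-cong linA e y)
        PBw : ∀ {w} → P w ≗ w → P (B w) ≗ B w
        PBw {w} e y = trans (PB w y) (≗-cong linB e y)
        PCw : ∀ {w} → P w ≗ w → P (C w) ≗ C w
        PCw {w} e y = trans (PC w y) (≗-cong linC e y)

        P-Q : P (Q A B C v) x ≡ comb₈ (v x) (A v x) (B v x) (C v x) (A (B v) x) (A (C v) x) (B (C v) x) (A (B (C v)) x)
        P-Q = trans (expand linP) (comb₈-cong (Pv x) (PAw Pv x) (PBw Pv x) (PCw Pv x)
          (PAw (PBw Pv) x) (PAw (PCw Pv) x) (PBw (PCw Pv) x) (PAw (PBw (PCw Pv)) x))

        A-Q : A (Q A B C v) x ≡ comb₈ (A v x) (A v x) (A (B v) x) (A (C v) x) (A (B v) x) (A (C v) x) (A (B (C v)) x) (A (B (C v)) x)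
        A-Q = trans (expand linA) (comb₈-cong (refl {x = A v x}) (idem avA v x) (refl {x = A (B v) x}) (refl {x = A (C v) x})
          (idem avA (B v) x) (idem avA (C v) x) (refl {x = A (B (C v)) x}) (idem avA (B (C v)) x))

        B-Q : B (Q A B C v) x ≡ comb₈ (B v x) (A (B v) x) (B v x) (B (C v) x) (A (B v) x) (A (B (C v)) x) (B (C v) x) (A (B (C v)) x)
        B-Q = trans (expand linB) (comb₈-cong (refl {x = B v x}) (AB v x) (idem avB v x) (refl {x = B (C v) x})
          (trans (AB (B v) x) (≗-cong linA (idem avB v) x)) (AB (C v) x) (idem avB (C v) x)
          (trans (AB (B (C v)) x) (≗-cong linA (idem avB (C v)) x)))

        C-Q : C (Q A B C v) x ≡ comb₈ (C v x) (A (C v) x) (B (C v) x) (C v x) (A (B (C v)) x) (A (C v) x) (B (C v) x) (A (B (C v)) x)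
        C-Q = trans (expand linC) (comb₈-cong (refl {x = C v x}) (AC v x) (BC v x) (idem avC v x)
          (trans (AC (B v) x) (≗-cong linA (BC v) x))
          (trans (AC (C v) x) (≗-cong linA (idem avC v) x))
          (CBC x)
          (trans (AC (B (C v)) x) (≗-cong linA CBC x)))
          where
          CBC : C (B (C v)) ≗ B (C v)
          CBC y = trans (BC (C v) y) (≗-cong linB (idem avC v) y)

-- The completion theorem for four commuting averaging operators

∣∣-dominated : ∀ p {q m} → 0ℚ ≤ p → ∣ q ∣ ≤ m → ∣ p * q ∣ ≤ p * m
∣∣-dominated p {q} {m} 0≤p q≤m = subst (λ z → ∣ p * q ∣ ≤ z * m) (0≤p⇒∣p∣≡p 0≤p) (∣*∣≤ p {q} q≤m)

union-bound : ∀ {p q} → p ≤ 1ℚ → q ≤ 1ℚ → 1ℚ - p * q ≤ (1ℚ - p) + (1ℚ - q)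
union-bound {p} {q} p≤1 q≤1 = 0≤q-p⇒p≤q (subst (0ℚ ≤_)
  (solve 2 (λ p q → (con 1ℚ :- p) :* (con 1ℚ :- q) := ((con 1ℚ :- p) :+ (con 1ℚ :- q)) :- (con 1ℚ :- p :* q)) refl p q)
  (0≤* (p≤q⇒0≤q-p p≤1) (p≤q⇒0≤q-p q≤1)))

≤1*≤1 : ∀ {p q} → 0ℚ ≤ p → p ≤ 1ℚ → q ≤ 1ℚ → p * q ≤ 1ℚ
≤1*≤1 {p} {q} 0≤p p≤1 q≤1 = ≤-trans (*-monoˡ 0≤p q≤1) (subst (_≤ 1ℚ) (sym (*-identityʳ p)) p≤1)

ε : ℚ
ε = + 1 / 101

module Completion {X : Set} {S : (X → ℚ) → ℚ} (def : IsDefinite S) (enum : Enumeration X)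
         {P : Fin 4 → Op X} (avg : ∀ t → Averaging S (P t))
         (comm : ∀ {s t} → s ≢ t → ∀ f → P s (P t f) ≗ P t (P s f))
         {φ : X → ℚ} (0≤φ : ∀ x → 0ℚ ≤ φ x)
         -- The abstract form of the Sudoku rules: where `φ` is nonzero, its average over each
         -- constraint through that point is exactly 1.
         (φ-absorbs : ∀ t x → P t φ x * φ x ≡ φ x)
         (φ-sparse : ∀ {s t} → s ≢ t → ∀ x → P s (P t φ) x ≤ ε) where

  open IsDefinite def
  open ≡-Reasoning

  lin : ∀ t → IsLinear (P t)
  lin t = linear (avg t)

  d : Fin 4 → X → ℚ
  d t = P t (λ y → 1ℚ - φ y)

  d≡1-Pφ : ∀ t x → d t x ≡ 1ℚ - P t φ x
  d≡1-Pφ t x = trans (+-hom (lin t) (λ _ → 1ℚ) (λ y → - φ y) x)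
    (cong₂ _+_ (const (avg t) 1ℚ x) (neg-hom (avg t) φ x))

  -- Pulling `P t φ` out of an average reduces its square to the average of `P t φ * φ`, which
  -- absorption turns into `P t φ`. Thus `P t φ` and `d t` take only the values 0 and 1.
  Pφ-idem : ∀ t x → P t φ x * P t φ x ≡ P t φ x
  Pφ-idem t x = trans (sym (pull-out (avg t) φ φ x)) (≗-cong (lin t) (φ-absorbs t) x)

  d-idem : ∀ t x → d t x * d t x ≡ d t x
  d-idem t x = begin
    d t x * d t x                       ≡⟨ cong₂ _*_ (d≡1-Pφ t x) (d≡1-Pφ t x) ⟩
    (1ℚ - p) * (1ℚ - p)                 ≡⟨ solve 1 (λ p → (con 1ℚ :- p) :* (con 1ℚ :- p) := con 1ℚ :- p :- p :+ p :* p) refl p ⟩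
    1ℚ - p - p + p * p                  ≡⟨ cong (λ z → 1ℚ - p - p + z) (Pφ-idem t x) ⟩
    1ℚ - p - p + p                      ≡⟨ solve 1 (λ p → con 1ℚ :- p :- p :+ p := con 1ℚ :- p) refl p ⟩
    1ℚ - p                              ≡⟨ sym (d≡1-Pφ t x) ⟩
    d t x                               ∎
    where p = P t φ x

  0≤d : ∀ t x → 0ℚ ≤ d t x
  0≤d t x = subst (0ℚ ≤_) (d-idem t x) (0≤p² (d t x))

  1-d≡Pφ : ∀ t x → 1ℚ - d t x ≡ P t φ x
  1-d≡Pφ t x = trans (cong (λ z → 1ℚ - z) (d≡1-Pφ t x)) (solve 1 (λ p → con 1ℚ :- (con 1ℚ :- p) := p) refl (P t φ x))

  d≤1 : ∀ t x → d t x ≤ 1ℚ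
  d≤1 t x = 0≤q-p⇒p≤q (subst (0ℚ ≤_) (sym (1-d≡Pφ t x)) (subst (0ℚ ≤_) (Pφ-idem t x) (0≤p² (P t φ x))))

  a : X → ℚ
  a x = Π₄ (λ t → d t x)

  d-pull-out : ∀ t f x → P t (λ y → d t y * f y) x ≡ d t x * P t f x
  d-pull-out t = pull-out (avg t) (λ y → 1ℚ - φ y)

  d*a : ∀ t x → d t x * a x ≡ a x
  d*a t x = begin
    p * a x                 ≡⟨ cong (p *_) (Π-punchIn (λ t → d t x) t) ⟩
    p * (p * r)             ≡⟨ sym (*-assoc p p r) ⟩
    p * p * r               ≡⟨ cong (_* r) (d-idem t x) ⟩
    p * r                   ≡⟨ sym (Π-punchIn (λ t → d t x) t) ⟩
    a x                     ∎
    where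
    p = d t x
    r = d (punchIn t 0F) x * (d (punchIn t 1F) x * d (punchIn t 2F) x)

  0≤a : ∀ x → 0ℚ ≤ a x
  0≤a x = 0≤* (0≤d 0F x) (0≤* (0≤d 1F x) (0≤* (0≤d 2F x) (0≤d 3F x)))

  others : Fin 4 → X → ℚ
  others t x = P (punchIn t 0F) φ x + (P (punchIn t 1F) φ x + P (punchIn t 2F) φ x)

  0≤d[1-a] : ∀ t x → 0ℚ ≤ d t x * (1ℚ - a x)
  0≤d[1-a] t x = 0≤* (0≤d t x) (p≤q⇒0≤q-p (≤1*≤1 (0≤d 0F x) (d≤1 0F x) (≤1*≤1 (0≤d 1F x) (d≤1 1F x) (≤1*≤1 (0≤d 2F x) (d≤1 2F x) (d≤1 3F x)))))

  -- Since `d t` absorbs into `a`, multiplying by it leaves in `1ℚ - a` only the product of the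
  -- other three factors, to which the union bound applies. The term `P t φ`, which the sparsity
  -- hypothesis does not control under `P t`, has disappeared.
  d[1-a]≤others : ∀ t x → d t x * (1ℚ - a x) ≤ others t x
  d[1-a]≤others t x = subst₂ _≤_ left right
    (≤-trans (*-monoʳ-≤-nonNeg z {{nonNegative 0≤z}} (d≤1 t x))
      (≤-trans (≤-reflexive (*-identityˡ z))
        (≤-trans (union-bound {p₀} {p₁ * p₂} (d≤1 t₀ x) (≤1*≤1 (0≤d t₁ x) (d≤1 t₁ x) (d≤1 t₂ x)))
          (+-monoʳ-≤ (1ℚ - p₀) (union-bound {p₁} {p₂} (d≤1 t₁ x) (d≤1 t₂ x))))))
    where
    t₀ = punchIn t 0F
    t₁ = punchIn t 1F
    t₂ = punchIn t 2F
    p₀ = d t₀ x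
    p₁ = d t₁ x
    p₂ = d t₂ x
    r = p₀ * (p₁ * p₂)
    z = 1ℚ - r

    0≤z : 0ℚ ≤ z
    0≤z = p≤q⇒0≤q-p (≤1*≤1 (0≤d t₀ x) (d≤1 t₀ x) (≤1*≤1 (0≤d t₁ x) (d≤1 t₁ x) (d≤1 t₂ x)))

    left : d t x * z ≡ d t x * (1ℚ - a x)
    left = begin
      d t x * (1ℚ - r)               ≡⟨ solve 2 (λ p r → p :* (con 1ℚ :- r) := p :- p :* r) refl (d t x) r ⟩
      d t x - d t x * r              ≡⟨ cong (λ z → d t x - z) (sym (trans (d*a t x) (Π-punchIn (λ t → d t x) t))) ⟩
      d t x - d t x * a x            ≡⟨ solve 2 (λ p r → p :- p :* r := p :* (con 1ℚ :- r)) refl (d t x) (a x) ⟩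
      d t x * (1ℚ - a x)             ∎

    right : (1ℚ - p₀) + ((1ℚ - p₁) + (1ℚ - p₂)) ≡ others t x
    right = cong₂ _+_ (1-d≡Pφ t₀ x) (cong₂ _+_ (1-d≡Pφ t₁ x) (1-d≡Pφ t₂ x))

  others-sparse : ∀ t x → P t (others t) x ≤ ε + (ε + ε)
  others-sparse t x = subst (_≤ ε + (ε + ε)) (sym expand)
    (+-mono-≤ (sparse 0F) (+-mono-≤ (sparse 1F) (sparse 2F)))
    where
    sparse : ∀ r → P t (P (punchIn t r) φ) x ≤ ε
    sparse r = φ-sparse (λ e → punchInᵢ≢i t r (sym e)) x
    expand : P t (others t) x ≡ P t (P (punchIn t 0F) φ) x + (P t (P (punchIn t 1F) φ) x + P t (P (punchIn t 2F) φ) x)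
    expand = trans (+-hom (lin t) (P (punchIn t 0F) φ) (λ y → P (punchIn t 1F) φ y + P (punchIn t 2F) φ y) x)
      (cong (λ z → P t (P (punchIn t 0F) φ) x + z) (+-hom (lin t) (P (punchIn t 1F) φ) (P (punchIn t 2F) φ) x))

  -- The mass that g puts on the cells unavailable to the unfilled constraint of type t through x.
  lost : Fin 4 → Op X
  lost t g x = d t x * P t (λ y → (1ℚ - a y) * g y) x

  lost-linear : ∀ t → IsLinear (lost t)
  lost-linear t = *-linear (d t) (∘-linear (lin t) (*-linear (λ y → 1ℚ - a y) id-linear))

  -- Places `lost t g` in the range of `P t`, which is where `Qₜ t` inverts the sum of the four
  -- averages.
  P-lost : ∀ t g x → P t (lost t g) x ≡ lost t g x
  P-lost t g x = trans (d-pull-out t (P t (λ y → (1ℚ - a y) * g y)) x)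
    (cong (d t x *_) (idem (avg t) (λ y → (1ℚ - a y) * g y) x))

  d*lost : ∀ t g x → d t x * lost t g x ≡ lost t g x
  d*lost t g x = trans (sym (*-assoc (d t x) (d t x) p)) (cong (_* p) (d-idem t x))
    where p = P t (λ y → (1ℚ - a y) * g y) x

  -- The factor `d t` is first carried back inside the average, so that the integrand is dominated
  -- by `m * others t` rather than by a function that also involves `P t φ`.
  lost-bound : ∀ t {m g} → 0ℚ ≤ m → ‖ g ‖≤ m → ‖ lost t g ‖≤ m * (ε + (ε + ε))
  lost-bound t {m} {g} 0≤m g≤m x = subst (λ z → ∣ z ∣ ≤ m * (ε + (ε + ε))) lost≡
    (≤-trans (∣∣-mono (avg t) {k = λ y → m * others t y} pointwise x)
      (≤-trans (≤-reflexive (*-hom (lin t) m (others t) x)) (*-monoˡ 0≤m (others-sparse t x))))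
    where
    lost≡ : P t (λ y → d t y * (1ℚ - a y) * g y) x ≡ lost t g x
    lost≡ = trans (≗-cong (lin t) (λ y → *-assoc (d t y) (1ℚ - a y) (g y)) x)
      (d-pull-out t (λ y → (1ℚ - a y) * g y) x)
    pointwise : ∀ y → ∣ d t y * (1ℚ - a y) * g y ∣ ≤ m * others t y
    pointwise y = ≤-trans (∣∣-dominated (d t y * (1ℚ - a y)) (0≤d[1-a] t y) (g≤m y))
      (≤-trans (≤-reflexive (*-comm (d t y * (1ℚ - a y)) m)) (*-monoˡ 0≤m (d[1-a]≤others t y)))

  Qₜ : Fin 4 → Op X
  Qₜ t = Q (P (punchIn t 0F)) (P (punchIn t 1F)) (P (punchIn t 2F))

  correction : Op X
  correction g x = Σℚ 4 (λ t → Qₜ t (lost t g) x)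

  correction-linear : IsLinear correction
  correction-linear = Σ-linear 4 λ t →
    ∘-linear (Q-linear (lin (punchIn t 0F)) (lin (punchIn t 1F)) (lin (punchIn t 2F))) (lost-linear t)

  correction-bound : Bounded ½ correction
  correction-bound {m} {g} 0≤m g≤m x = ≤-trans
    (∣Σ∣≤ 4 {λ t → Qₜ t (lost t g) x} (λ t → Q-bound (avg (punchIn t 0F)) (avg (punchIn t 1F)) (avg (punchIn t 2F))
      {lost t g} (lost-bound t {m} {g} 0≤m g≤m) x))
    (subst (_≤ ½ * m)
      -- Four summands, each at most 15/4 · 3ε · `m`, give 45ε · `m`. This is within `½ * m`
      -- precisely for ε up to 1/90.
      (solve 1 (λ m → con (+ 45 / 101) :* m :=
        let k = con (+ 15 / 4) :* (m :* (con ε :+ (con ε :+ con ε))) in k :+ (k :+ (k :+ (k :+ con 0ℚ)))) refl m)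
      (*-monoʳ-≤-nonNeg m {{nonNegative 0≤m}} {+ 45 / 101} {½} (from-yes (+ 45 / 101 ≤? ½))))

  solution = nonneg-fixed-point enum correction-linear correction-bound

  g : X → ℚ
  g = proj₁ solution

  w : X → ℚ
  w = correction g

  g≡1+w : ∀ x → g x ≡ 1ℚ + w x
  g≡1+w = proj₁ (proj₂ solution)

  0≤g : ∀ x → 0ℚ ≤ g x
  0≤g = proj₂ (proj₂ solution)

  Q-inverseₜ : ∀ t {v} → P t v ≗ v → ∀ x → Σℚ 4 (λ s → P s (Qₜ t v) x) ≡ v x
  Q-inverseₜ t {v} Pv x = trans (Σ-punchIn (λ s → P s (Qₜ t v) x) t)
    (Q-inverse (avg (punchIn t 0F)) (avg (punchIn t 1F)) (avg (punchIn t 2F))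
      (comm (punchIn-≢ λ ())) (comm (punchIn-≢ λ ())) (comm (punchIn-≢ λ ()))
      (lin t) (comm (t≢ 0F)) (comm (t≢ 1F)) (comm (t≢ 2F)) Pv x)
    where
    t≢ : ∀ r → t ≢ punchIn t r
    t≢ r e = punchInᵢ≢i t r (sym e)
    punchIn-≢ : ∀ {r s} → r ≢ s → punchIn t r ≢ punchIn t s
    punchIn-≢ r≢s e = r≢s (punchIn-injective t _ _ e)

  -- The defect of type `t`: the mass lost in a constraint minus what the correction `w` gives back
  -- to it.
  u : Fin 4 → X → ℚ
  u t x = lost t g x + - 1ℚ * P t w x

  -- After exchanging the two sums, the four averages of `Qₜ s (lost s g)` add up to `lost s g` for
  -- each `s`. Hence the averages of `w` add up to the total lost mass.
  Σu≡0 : ∀ x → Σℚ 4 (λ t → u t x) ≡ 0ℚ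
  Σu≡0 x = begin
    Σℚ 4 (λ t → lost t g x + - 1ℚ * P t w x)                             ≡⟨ Σ-+ 4 (λ t → lost t g x) (λ t → - 1ℚ * P t w x) ⟩
    L + Σℚ 4 (λ t → - 1ℚ * P t w x)                                      ≡⟨ cong (λ z → L + z) (Σ-* 4 (- 1ℚ) (λ t → P t w x)) ⟩
    L + - 1ℚ * Σℚ 4 (λ t → P t w x)                                      ≡⟨ cong (λ z → L + - 1ℚ * z) ΣPw ⟩
    L + - 1ℚ * L                                                         ≡⟨ solve 1 (λ l → l :+ con (- 1ℚ) :* l := con 0ℚ) refl L ⟩
    0ℚ                                                                   ∎
    where
    L = Σℚ 4 (λ t → lost t g x)
    ΣPw : Σℚ 4 (λ t → P t w x) ≡ L
    ΣPw = begin
      Σℚ 4 (λ t → P t w x)                                    ≡⟨ Σ-cong 4 (λ t → Σ-hom (lin t) 4 (λ s → Qₜ s (lost s g)) x) ⟩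
      Σℚ 4 (λ t → Σℚ 4 (λ s → P t (Qₜ s (lost s g)) x))       ≡⟨ Σ-swap 4 4 (λ t s → P t (Qₜ s (lost s g)) x) ⟩
      Σℚ 4 (λ s → Σℚ 4 (λ t → P t (Qₜ s (lost s g)) x))       ≡⟨ Σ-cong 4 (λ s → Q-inverseₜ s {lost s g} (P-lost s g) x) ⟩
      L                                                       ∎

  Pu : ∀ t x → P t (u t) x ≡ u t x
  Pu t x = trans (axpy-hom (lin t) (lost t g) (- 1ℚ) (P t w) x)
    (cong₂ (λ y z → y + - 1ℚ * z) (P-lost t g x) (idem (avg t) w x))

  h : X → ℚ
  h x = a x * g x

  ψ : X → ℚ
  ψ x = (1ℚ - φ x) + - 1ℚ * h x

  P-h : ∀ t x → P t h x ≡ d t x * P t h x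
  P-h t x = trans (≗-cong (lin t) (λ y → trans (cong (_* g y) (sym (d*a t y))) (*-assoc (d t y) (a y) (g y))) x)
    (d-pull-out t h x)

  -- Writing `h` as `g` minus `(1ℚ - a) * g` and using that `g` is `1ℚ + w` expresses `P t h`
  -- through `P t w` and the lost average. Its constant part `d t` cancels against the average of
  -- `1ℚ - φ`, which is `d t` by definition.
  P-ψ : ∀ t x → P t ψ x ≡ d t x * u t x
  P-ψ t x = begin
    P t ψ x                                ≡⟨ axpy-hom (lin t) (λ y → 1ℚ - φ y) (- 1ℚ) h x ⟩
    p + - 1ℚ * P t h x                     ≡⟨ cong (λ z → p + - 1ℚ * z) (trans (P-h t x) (cong (p *_) P-h′)) ⟩
    p + - 1ℚ * (p * ((1ℚ + P t w x) + - 1ℚ * c)) ≡⟨ solve 3 (λ p w c → p :+ con (- 1ℚ) :* (p :* ((con 1ℚ :+ w) :+ con (- 1ℚ) :* c)) := p :* c :+ p :* (con (- 1ℚ) :* w)) refl p (P t w x) c ⟩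
    -- Idempotence of `d t` supplies a second factor, so that the bracket can be `u t`, which is
    -- fixed by `P t`, and not merely some function with the same product.
    p * c + p * (- 1ℚ * P t w x)           ≡⟨ cong (λ z → z + p * (- 1ℚ * P t w x)) (sym (d*lost t g x)) ⟩
    p * (p * c) + p * (- 1ℚ * P t w x)     ≡⟨ sym (*-distribˡ-+ p (p * c) (- 1ℚ * P t w x)) ⟩
    p * (p * c + - 1ℚ * P t w x)           ∎
    where
    p = d t x
    c = P t (λ y → (1ℚ - a y) * g y) x
    P-h′ : P t h x ≡ (1ℚ + P t w x) + - 1ℚ * c
    P-h′ = begin
      P t h x                                                    ≡⟨ ≗-cong (lin t) (λ y → trans
                                                                      (solve 2 (λ a g → a :* g := g :+ con (- 1ℚ) :* ((con 1ℚ :- a) :* g)) refl (a y) (g y))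
                                                                      (cong (λ z → z + - 1ℚ * ((1ℚ - a y) * g y)) (g≡1+w y))) x ⟩
      P t (λ y → (1ℚ + w y) + - 1ℚ * ((1ℚ - a y) * g y)) x       ≡⟨ axpy-hom (lin t) (λ y → 1ℚ + w y) (- 1ℚ) (λ y → (1ℚ - a y) * g y) x ⟩
      P t (λ y → 1ℚ + w y) x + - 1ℚ * c                          ≡⟨ cong (λ z → z + - 1ℚ * c) (trans (+-hom (lin t) (λ _ → 1ℚ) w x) (cong (λ z → z + P t w x) (const (avg t) 1ℚ x))) ⟩
      (1ℚ + P t w x) + - 1ℚ * c                                  ∎

  [Pψ]² : ∀ t x → P t ψ x * P t ψ x ≡ u t x * P t ψ x
  [Pψ]² t x = begin
    P t ψ x * P t ψ x             ≡⟨ cong₂ _*_ (P-ψ t x) (P-ψ t x) ⟩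
    (p * q) * (p * q)             ≡⟨ solve 2 (λ p q → (p :* q) :* (p :* q) := q :* ((p :* p) :* q)) refl p q ⟩
    q * ((p * p) * q)             ≡⟨ cong (λ z → q * (z * q)) (d-idem t x) ⟩
    q * (p * q)                   ≡⟨ cong (q *_) (sym (P-ψ t x)) ⟩
    q * P t ψ x                   ∎
    where
    p = d t x
    q = u t x

  S[Pψ]²≡0 : S (λ x → Σℚ 4 (λ t → P t ψ x * P t ψ x)) ≡ 0ℚ
  S[Pψ]²≡0 = begin
    S (λ x → Σℚ 4 (λ t → P t ψ x * P t ψ x))   ≡⟨ S-cong (λ x → Σ-cong 4 (λ t → [Pψ]² t x)) ⟩
    S (λ x → Σℚ 4 (λ t → u t x * P t ψ x))     ≡⟨ S-Σ 4 (λ t x → u t x * P t ψ x) ⟩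
    Σℚ 4 (λ t → S (λ x → u t x * P t ψ x))     ≡⟨ Σ-cong 4 (λ t → sym (self-adjoint (avg t) (u t) ψ)) ⟩
    Σℚ 4 (λ t → S (λ x → P t (u t) x * ψ x))   ≡⟨ Σ-cong 4 (λ t → S-cong (λ x → trans (cong (_* ψ x) (Pu t x)) (*-comm (u t x) (ψ x)))) ⟩
    Σℚ 4 (λ t → S (λ x → ψ x * u t x))         ≡⟨ sym (S-Σ 4 (λ t x → ψ x * u t x)) ⟩
    S (λ x → Σℚ 4 (λ t → ψ x * u t x))         ≡⟨ S-cong (λ x → trans (Σ-* 4 (ψ x) (λ t → u t x)) (trans (cong (ψ x *_) (Σu≡0 x)) (*-zeroʳ (ψ x)))) ⟩
    S (λ _ → 0ℚ)                               ≡⟨ S-0 ⟩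
    0ℚ                                         ∎

  Pψ≡0 : ∀ t x → P t ψ x ≡ 0ℚ
  Pψ≡0 t x = p²≡0⇒p≡0 (P t ψ x) (Σ≡0⇒term≡0 4 {λ t → P t ψ x * P t ψ x} (λ t → 0≤p² (P t ψ x))
    (S-definite (λ x → Σ-nonneg 4 {λ t → P t ψ x * P t ψ x} (λ t → 0≤p² (P t ψ x))) S[Pψ]²≡0 x) t)

  averages-completable : ∃ λ (h : X → ℚ) → (∀ x → 0ℚ ≤ h x) × (∀ t x → P t (λ y → h y + φ y) x ≡ 1ℚ)
  averages-completable = h , (λ x → 0≤* (0≤a x) (0≤g x)) , λ t x → begin
    P t (λ y → h y + φ y) x             ≡⟨ ≗-cong (lin t) (λ y → solve 2 (λ h φ → h :+ φ := con 1ℚ :+ con (- 1ℚ) :* ((con 1ℚ :- φ) :+ con (- 1ℚ) :* h)) refl (h y) (φ y)) x ⟩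
    P t (λ y → 1ℚ + - 1ℚ * ψ y) x       ≡⟨ axpy-hom (lin t) (λ _ → 1ℚ) (- 1ℚ) ψ x ⟩
    P t (λ _ → 1ℚ) x + - 1ℚ * P t ψ x   ≡⟨ cong₂ (λ y z → y + - 1ℚ * z) (const (avg t) 1ℚ x) (Pψ≡0 t x) ⟩
    1ℚ + - 1ℚ * 0ℚ                      ≡⟨⟩
    1ℚ                                  ∎

-- Indicators, and natural numbers as rationals

χ : Bool → ℚ
χ b = if b then 1ℚ else 0ℚ

0≤χ : ∀ b → 0ℚ ≤ χ b
0≤χ true  = nonNegative⁻¹ 1ℚ
0≤χ false = ≤-refl

χ-∧ : ∀ a b → χ (a ∧ b) ≡ χ a * χ b
χ-∧ true  b = sym (*-identityˡ (χ b))
χ-∧ false b = sym (*-zeroˡ (χ b))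

≡ᵇ-refl : ∀ m → (m ≡ᵇ m) ≡ true
≡ᵇ-refl zero    = refl
≡ᵇ-refl (suc m) = ≡ᵇ-refl m

≡ᵇ-sym : ∀ m n → (m ≡ᵇ n) ≡ (n ≡ᵇ m)
≡ᵇ-sym zero    zero    = refl
≡ᵇ-sym zero    (suc n) = refl
≡ᵇ-sym (suc m) zero    = refl
≡ᵇ-sym (suc m) (suc n) = ≡ᵇ-sym m n

≡ᵇ-true : ∀ m n → (m ≡ᵇ n) ≡ true → m ≡ n
≡ᵇ-true m n e = ℕ.≡ᵇ⇒≡ m n (subst T (sym e) _)

≢⇒≡ᵇ-false : ∀ m n → m ≢ n → (m ≡ᵇ n) ≡ false
≢⇒≡ᵇ-false m n m≢n with m ≡ᵇ n in e
... | true  = contradiction (≡ᵇ-true m n e) m≢n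
... | false = refl

ι : ℕ → ℚ
ι zero    = 0ℚ
ι (suc n) = 1ℚ + ι n

ι-+ : ∀ m n → ι (m ℕ.+ n) ≡ ι m + ι n
ι-+ zero    n = sym (+-identityˡ (ι n))
ι-+ (suc m) n = trans (cong (λ z → 1ℚ + z) (ι-+ m n)) (sym (+-assoc 1ℚ (ι m) (ι n)))

ι-* : ∀ m n → ι (m ℕ.* n) ≡ ι m * ι n
ι-* zero    n = sym (*-zeroˡ (ι n))
ι-* (suc m) n = trans (ι-+ n (m ℕ.* n)) (trans (cong (λ z → ι n + z) (ι-* m n))
  (solve 2 (λ m n → n :+ m :* n := (con 1ℚ :+ m) :* n) refl (ι m) (ι n)))

0≤ι : ∀ n → 0ℚ ≤ ι n
0≤ι zero    = ≤-refl
0≤ι (suc n) = 0≤+ (nonNegative⁻¹ 1ℚ) (0≤ι n)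

ι-mono : ∀ {m n} → m ℕ.≤ n → ι m ≤ ι n
ι-mono {n = n} ℕ.z≤n = 0≤ι n
ι-mono (ℕ.s≤s m≤n)   = +-monoʳ-≤ 1ℚ (ι-mono m≤n)

ι-χ : ∀ b → ι (if b then 1 else 0) ≡ χ b
ι-χ true  = refl
ι-χ false = refl

ι-Σ : ∀ n (f : Fin n → ℕ) → ι (Σℕ n f) ≡ Σℚ n (λ i → ι (f i))
ι-Σ zero    f = refl
ι-Σ (suc n) f = trans (ι-+ (f zero) (Σℕ n (f ∘ suc))) (cong (λ z → ι (f zero) + z) (ι-Σ n (f ∘ suc)))

ι-count : ∀ n (p : Fin n → Bool) → ι (count n p) ≡ Σℚ n (λ i → χ (p i))
ι-count n p = trans (ι-Σ n (λ t → if p t then 1 else 0)) (Σ-cong n (λ i → ι-χ (p i)))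

abstract
  ι-reciprocal : ∀ n → ∃ λ r → 0ℚ ≤ r × r * ι (suc n) ≡ 1ℚ
  ι-reciprocal n = 1/ ι (suc n) , <⇒≤ (positive⁻¹ (1/ ι (suc n)) {{1/pos⇒pos (ι (suc n))}}) , *-inverseˡ (ι (suc n))
    where
    instance
      ι-pos : Positive (ι (suc n))
      ι-pos = positive (<-≤-trans (positive⁻¹ 1ℚ) (subst (_≤ ι (suc n)) (+-identityʳ 1ℚ) (+-monoʳ-≤ 1ℚ (0≤ι n))))
      ι-nonZero : NonZero (ι (suc n))
      ι-nonZero = pos⇒nonZero (ι (suc n))

density : ∀ {r m} c → 0ℚ ≤ r → r * ι m ≡ 1ℚ → 101 ℕ.* c ℕ.≤ m → r * ι c ≤ ε
density {r} {m} c 0≤r rm≡1 c≤ = subst₂ _≤_ left (*-identityʳ ε)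
  (*-monoˡ {ε} (nonNegative⁻¹ ε) (subst (r * (ι 101 * ι c) ≤_) rm≡1
    (*-monoˡ 0≤r (subst (_≤ ι m) (ι-* 101 c) (ι-mono c≤)))))
  where
  left : ε * (r * (ι 101 * ι c)) ≡ r * ι c
  left = solve 2 (λ r c → con ε :* (r :* (con (ι 101) :* c)) := r :* c) refl r (ι c)

χ-*-cong : ∀ b {p q} → (b ≡ true → p ≡ q) → χ b * p ≡ χ b * q
χ-*-cong true  e = cong (1ℚ *_) (e refl)
χ-*-cong false {p} {q} e = trans (*-zeroˡ p) (sym (*-zeroˡ q))

-- Means over the classes of a partition

-- The classes are the fibres of `cls`. A single factor `r`, the reciprocal of the class size,
-- suffices because bundles of one kind all have equal size.
mean : ∀ {n} → ℚ → (Fin n → ℕ) → Op (Fin n)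
mean {n} r cls f i = r * Σℚ n (λ j → χ (cls j ≡ᵇ cls i) * f j)

module _ {n : ℕ} (r : ℚ) (cls : Fin n → ℕ) where

  private
    ~ : Fin n → Fin n → ℚ
    ~ i j = χ (cls j ≡ᵇ cls i)

  mean-class : ∀ f {i j} → cls i ≡ cls j → mean r cls f i ≡ mean r cls f j
  mean-class f e = cong (λ c → r * Σℚ n (λ j → χ (cls j ≡ᵇ c) * f j)) e

  mean-linear : IsLinear (mean r cls)
  mean-linear .≗-cong e i = cong (r *_) (Σ-cong n (λ j → cong (~ i j *_) (e j)))
  mean-linear .+-hom f g i = trans
    (cong (r *_) (trans (Σ-cong n (λ j → *-distribˡ-+ (~ i j) (f j) (g j))) (Σ-+ n (λ j → ~ i j * f j) (λ j → ~ i j * g j))))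
    (*-distribˡ-+ r (Σℚ n (λ j → ~ i j * f j)) (Σℚ n (λ j → ~ i j * g j)))
  mean-linear .*-hom c f i = trans
    (cong (r *_) (trans (Σ-cong n (λ j → solve 3 (λ x c y → x :* (c :* y) := c :* (x :* y)) refl (~ i j) c (f j))) (Σ-* n c (λ j → ~ i j * f j))))
    (solve 3 (λ r c y → r :* (c :* y) := c :* (r :* y)) refl r c (Σℚ n (λ j → ~ i j * f j)))

  -- A mean is a finite linear combination of evaluations, and a linear operator acting on a
  -- different variable passes through such a combination.
  mean-commute : ∀ {X : Set} {A : Op X} → IsLinear A → ∀ (F : X → Fin n → ℚ) x i →
                 A (λ y → mean r cls (F y) i) x ≡ mean r cls (λ j → A (λ y → F y j) x) i
  mean-commute {A = A} lin F x i = begin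
    A (λ y → r * Σℚ n (λ j → ~ i j * F y j)) x          ≡⟨ *-hom lin r (λ y → Σℚ n (λ j → ~ i j * F y j)) x ⟩
    r * A (λ y → Σℚ n (λ j → ~ i j * F y j)) x          ≡⟨ cong (r *_) (Σ-hom lin n (λ j y → ~ i j * F y j) x) ⟩
    r * Σℚ n (λ j → A (λ y → ~ i j * F y j) x)          ≡⟨ cong (r *_) (Σ-cong n (λ j → *-hom lin (~ i j) (λ y → F y j) x)) ⟩
    r * Σℚ n (λ j → ~ i j * A (λ y → F y j) x)          ∎
    where open ≡-Reasoning

  mean-isolated : ∀ f i → (∀ j → j ≢ i → cls j ≡ cls i → f j ≡ 0ℚ) → mean r cls f i ≡ r * f i
  mean-isolated f i isolated = cong (r *_) (trans
    (Σ-single n i (λ j j≢i → trans (χ-*-cong (cls j ≡ᵇ cls i) (λ e → isolated j j≢i (≡ᵇ-true (cls j) (cls i) e))) (*-zeroʳ (~ i j))))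
    (trans (cong (λ b → χ b * f i) (≡ᵇ-refl (cls i))) (*-identityˡ (f i))))

  -- `total` says that every class has size 1/r. Then `pull-out` holds because a mean is constant on
  -- classes, and self-adjointness because the relation of lying in the same class is symmetric.
  mean-averaging : 0ℚ ≤ r → (∀ i → r * Σℚ n (λ j → ~ i j) ≡ 1ℚ) → Averaging (Σℚ n) (mean r cls)
  mean-averaging 0≤r total .linear = mean-linear
  mean-averaging 0≤r total .mono f≤g i = *-monoˡ 0≤r (Σ-mono n (λ j → *-monoˡ (0≤χ (cls j ≡ᵇ cls i)) (f≤g j)))
  mean-averaging 0≤r total .const c i = begin
    r * Σℚ n (λ j → ~ i j * c)        ≡⟨ cong (r *_) (trans (Σ-cong n (λ j → *-comm (~ i j) c)) (Σ-* n c (~ i))) ⟩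
    r * (c * Σℚ n (~ i))              ≡⟨ solve 3 (λ r c y → r :* (c :* y) := c :* (r :* y)) refl r c (Σℚ n (~ i)) ⟩
    c * (r * Σℚ n (~ i))              ≡⟨ cong (c *_) (total i) ⟩
    c * 1ℚ                            ≡⟨ *-identityʳ c ⟩
    c                                 ∎
    where open ≡-Reasoning
  mean-averaging 0≤r total .pull-out f g i = begin
    r * Σℚ n (λ j → ~ i j * (m j * g j))   ≡⟨ cong (r *_) (Σ-cong n (λ j → χ-*-cong (cls j ≡ᵇ cls i)
                                                (λ e → cong (_* g j) (mean-class f (≡ᵇ-true (cls j) (cls i) e))))) ⟩
    r * Σℚ n (λ j → ~ i j * (m i * g j))   ≡⟨ *-hom mean-linear (m i) g i ⟩
    m i * mean r cls g i                   ∎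
    where
    open ≡-Reasoning
    m = mean r cls f
  mean-averaging 0≤r total .self-adjoint f g = begin
    Σℚ n (λ i → r * Σℚ n (λ j → ~ i j * f j) * g i)    ≡⟨ Σ-cong n (λ i → inside f g i) ⟩
    Σℚ n (λ i → Σℚ n (λ j → r * (~ i j * f j * g i)))  ≡⟨ Σ-swap n n (λ i j → r * (~ i j * f j * g i)) ⟩
    Σℚ n (λ j → Σℚ n (λ i → r * (~ i j * f j * g i)))  ≡⟨ Σ-cong n (λ j → Σ-cong n (λ i → flip i j)) ⟩
    Σℚ n (λ j → Σℚ n (λ i → r * (~ j i * g i * f j)))  ≡⟨ Σ-cong n (λ j → trans (sym (inside g f j)) (*-comm (mean r cls g j) (f j))) ⟩
    Σℚ n (λ j → f j * mean r cls g j)                  ∎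
    where
    open ≡-Reasoning
    flip : ∀ i j → r * (~ i j * f j * g i) ≡ r * (~ j i * g i * f j)
    flip i j = cong (r *_) (trans (cong (λ b → χ b * f j * g i) (≡ᵇ-sym (cls j) (cls i)))
      (solve 3 (λ x y z → x :* y :* z := x :* z :* y) refl (~ j i) (f j) (g i)))
    inside : ∀ f g i → r * Σℚ n (λ j → ~ i j * f j) * g i ≡ Σℚ n (λ j → r * (~ i j * f j * g i))
    inside f g i = begin
      r * Σℚ n (λ j → ~ i j * f j) * g i           ≡⟨ solve 3 (λ r s g → r :* s :* g := r :* (g :* s)) refl r (Σℚ n (λ j → ~ i j * f j)) (g i) ⟩
      r * (g i * Σℚ n (λ j → ~ i j * f j))         ≡⟨ cong (r *_) (sym (Σ-* n (g i) (λ j → ~ i j * f j))) ⟩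
      r * Σℚ n (λ j → g i * (~ i j * f j))         ≡⟨ cong (r *_) (Σ-cong n (λ j → *-comm (g i) (~ i j * f j))) ⟩
      r * Σℚ n (λ j → ~ i j * f j * g i)           ≡⟨ sym (Σ-* n r (λ j → ~ i j * f j * g i)) ⟩
      Σℚ n (λ j → r * (~ i j * f j * g i))         ∎

all : ∀ {n} → Fin n → ℕ
all _ = 0

mean-all : ∀ {n} r (f : Fin n → ℚ) i → mean r all f i ≡ r * Σℚ n f
mean-all {n} r f i = cong (r *_) (Σ-cong n (λ j → *-identityˡ (f j)))

-- Self-adjointness against the constant 1, which `A` fixes, shows that `A` preserves the total.
mean-all-absorbs : ∀ {n} r {A} → Averaging (Σℚ n) A → ∀ f i → mean r all (A f) i ≡ mean r all f i
mean-all-absorbs {n} r {A} avA f i = trans (mean-all r (A f) i) (trans (cong (r *_) Σ-A) (sym (mean-all r f i)))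
  where
  open ≡-Reasoning
  Σ-A : Σℚ n (A f) ≡ Σℚ n f
  Σ-A = begin
    Σℚ n (A f)                          ≡⟨ Σ-cong n (λ j → sym (*-identityʳ (A f j))) ⟩
    Σℚ n (λ j → A f j * 1ℚ)             ≡⟨ self-adjoint avA f (λ _ → 1ℚ) ⟩
    Σℚ n (λ j → f j * A (λ _ → 1ℚ) j)   ≡⟨ Σ-cong n (λ j → trans (cong (f j *_) (const avA 1ℚ j)) (*-identityʳ (f j))) ⟩
    Σℚ n f                              ∎

∘-averaging : ∀ {X : Set} {S} {A B : Op X} → Averaging S A → Averaging S B → (∀ f → A (B f) ≗ B (A f)) →
              (∀ {f g} → f ≗ g → S f ≡ S g) → Averaging S (λ f → A (B f))
∘-averaging {X} {S} {A} {B} a b AB S-cong = record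
  { linear = ∘-linear (linear a) (linear b)
  ; mono = λ f≤g → mono a (mono b f≤g)
  ; const = λ c x → trans (≗-cong (linear a) (const b c) x) (const a c x)
  ; pull-out = λ f g x → begin
      A (B (λ y → A (B f) y * g y)) x      ≡⟨ ≗-cong (linear a) (≗-cong (linear b) (λ y → cong (_* g y) (AB f y))) x ⟩
      A (B (λ y → B (A f) y * g y)) x      ≡⟨ ≗-cong (linear a) (pull-out b (A f) g) x ⟩
      A (λ y → B (A f) y * B g y) x        ≡⟨ ≗-cong (linear a) (λ y → cong (_* B g y) (sym (AB f y))) x ⟩
      A (λ y → A (B f) y * B g y) x        ≡⟨ pull-out a (B f) (B g) x ⟩
      A (B f) x * A (B g) x                ∎
  ; self-adjoint = λ f g → begin
      S (λ x → A (B f) x * g x)            ≡⟨ self-adjoint a (B f) g ⟩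
      S (λ x → B f x * A g x)              ≡⟨ self-adjoint b f (A g) ⟩
      S (λ x → f x * B (A g) x)            ≡⟨ S-cong (λ x → cong (f x *_) (sym (AB g x))) ⟩
      S (λ x → f x * A (B g) x)            ∎ }
  where open ≡-Reasoning

-- Averaging over one coordinate of a triple

Triple : ℕ → Set
Triple n = Fin n × Fin n × Fin n

Σ³ : ∀ n → (Triple n → ℚ) → ℚ
Σ³ n f = Σℚ n (λ i → Σℚ n (λ j → Σℚ n (λ k → f (i , j , k))))

enumeration : ∀ n → Enumeration (Triple n)
enumeration n = record
  { size = n ℕ.* (n ℕ.* n)
  ; index = λ { (i , j , k) → combine i (combine j k) }
  ; at = at
  ; at-index = λ { (i , j , k) → trans
      (cong (λ { (i , l) → i , remQuot {n} n l }) (remQuot-combine {n} {n ℕ.* n} i (combine j k)))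
      (cong (i ,_) (remQuot-combine {n} {n} j k)) } }
  where
  at : Fin (n ℕ.* (n ℕ.* n)) → Triple n
  at l with remQuot {n} (n ℕ.* n) l
  ... | i , l′ = i , remQuot {n} n l′

module _ (n : ℕ) where

  Σ³-cong : ∀ {f g : Triple n → ℚ} → f ≗ g → Σ³ n f ≡ Σ³ n g
  Σ³-cong e = Σ-cong n λ i → Σ-cong n λ j → Σ-cong n λ k → e (i , j , k)

  Σ³-definite : IsDefinite (Σ³ n)
  Σ³-definite = record
    { S-cong = Σ³-cong
    ; S-+ = λ f g → trans
        (Σ-cong n λ i → trans
          (Σ-cong n λ j → Σ-+ n (λ k → f (i , j , k)) (λ k → g (i , j , k)))
          (Σ-+ n (λ j → Σℚ n (λ k → f (i , j , k))) (λ j → Σℚ n (λ k → g (i , j , k)))))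
        (Σ-+ n (λ i → Σℚ n (λ j → Σℚ n (λ k → f (i , j , k)))) (λ i → Σℚ n (λ j → Σℚ n (λ k → g (i , j , k)))))
    ; S-definite = λ { 0≤f e (i , j , k) →
        Σ≡0⇒term≡0 n (λ k → 0≤f (i , j , k))
          (Σ≡0⇒term≡0 n (λ j → Σ-nonneg n (λ k → 0≤f (i , j , k)))
            (Σ≡0⇒term≡0 n (λ i → Σ-nonneg n (λ j → Σ-nonneg n (λ k → 0≤f (i , j , k)))) e i) j) k } }

  Σ³-rotate₁ : ∀ f → Σ³ n f ≡ Σℚ n (λ j → Σℚ n (λ k → Σℚ n (λ i → f (i , j , k))))
  Σ³-rotate₁ f = trans (Σ-swap n n (λ i j → Σℚ n (λ k → f (i , j , k))))
    (Σ-cong n λ j → Σ-swap n n (λ i k → f (i , j , k)))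

  Σ³-rotate₂ : ∀ f → Σ³ n f ≡ Σℚ n (λ i → Σℚ n (λ k → Σℚ n (λ j → f (i , j , k))))
  Σ³-rotate₂ f = Σ-cong n λ i → Σ-swap n n (λ j k → f (i , j , k))

  lift₁ lift₂ lift₃ : Op (Fin n) → Op (Triple n)
  lift₁ A f (i , j , k) = A (λ i′ → f (i′ , j , k)) i
  lift₂ A f (i , j , k) = A (λ j′ → f (i , j′ , k)) j
  lift₃ A f (i , j , k) = A (λ k′ → f (i , j , k′)) k

  module _ {A : Op (Fin n)} (a : Averaging (Σℚ n) A) where

    lift₁-averaging : Averaging (Σ³ n) (lift₁ A)
    lift₁-averaging .linear .≗-cong e (i , j , k) = ≗-cong (linear a) (λ i → e (i , j , k)) i
    lift₁-averaging .linear .+-hom f g (i , j , k) = +-hom (linear a) (λ i → f (i , j , k)) (λ i → g (i , j , k)) i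
    lift₁-averaging .linear .*-hom c f (i , j , k) = *-hom (linear a) c (λ i → f (i , j , k)) i
    lift₁-averaging .mono f≤g (i , j , k) = mono a (λ i → f≤g (i , j , k)) i
    lift₁-averaging .const c (i , j , k) = const a c i
    lift₁-averaging .pull-out f g (i , j , k) = pull-out a (λ i → f (i , j , k)) (λ i → g (i , j , k)) i
    lift₁-averaging .self-adjoint f g = trans (Σ³-rotate₁ (λ x → lift₁ A f x * g x)) (trans
      (Σ-cong n λ j → Σ-cong n λ k → self-adjoint a (λ i → f (i , j , k)) (λ i → g (i , j , k)))
      (sym (Σ³-rotate₁ (λ x → f x * lift₁ A g x))))

    lift₂-averaging : Averaging (Σ³ n) (lift₂ A)
    lift₂-averaging .linear .≗-cong e (i , j , k) = ≗-cong (linear a) (λ j → e (i , j , k)) j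
    lift₂-averaging .linear .+-hom f g (i , j , k) = +-hom (linear a) (λ j → f (i , j , k)) (λ j → g (i , j , k)) j
    lift₂-averaging .linear .*-hom c f (i , j , k) = *-hom (linear a) c (λ j → f (i , j , k)) j
    lift₂-averaging .mono f≤g (i , j , k) = mono a (λ j → f≤g (i , j , k)) j
    lift₂-averaging .const c (i , j , k) = const a c j
    lift₂-averaging .pull-out f g (i , j , k) = pull-out a (λ j → f (i , j , k)) (λ j → g (i , j , k)) j
    lift₂-averaging .self-adjoint f g = trans (Σ³-rotate₂ (λ x → lift₂ A f x * g x)) (trans
      (Σ-cong n λ i → Σ-cong n λ k → self-adjoint a (λ j → f (i , j , k)) (λ j → g (i , j , k)))
      (sym (Σ³-rotate₂ (λ x → f x * lift₂ A g x))))

    lift₃-averaging : Averaging (Σ³ n) (lift₃ A)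
    lift₃-averaging .linear .≗-cong e (i , j , k) = ≗-cong (linear a) (λ k → e (i , j , k)) k
    lift₃-averaging .linear .+-hom f g (i , j , k) = +-hom (linear a) (λ k → f (i , j , k)) (λ k → g (i , j , k)) k
    lift₃-averaging .linear .*-hom c f (i , j , k) = *-hom (linear a) c (λ k → f (i , j , k)) k
    lift₃-averaging .mono f≤g (i , j , k) = mono a (λ k → f≤g (i , j , k)) k
    lift₃-averaging .const c (i , j , k) = const a c k
    lift₃-averaging .pull-out f g (i , j , k) = pull-out a (λ k → f (i , j , k)) (λ k → g (i , j , k)) k
    lift₃-averaging .self-adjoint f g =
      Σ-cong n λ i → Σ-cong n λ j → self-adjoint a (λ k → f (i , j , k)) (λ k → g (i , j , k))

-- Bundles and boxes

Σ-splitAt : ∀ m n (g : ℕ → ℚ) →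
            Σℚ (m ℕ.+ n) (λ i → g (toℕ i)) ≡ Σℚ m (λ i → g (toℕ i)) + Σℚ n (λ i → g (m ℕ.+ toℕ i))
Σ-splitAt zero    n g = sym (+-identityˡ (Σℚ n (λ i → g (toℕ i))))
Σ-splitAt (suc m) n g = trans (cong (λ z → g 0 + z) (Σ-splitAt m n (g ∘ suc)))
  (sym (+-assoc (g 0) (Σℚ m (λ i → g (suc (toℕ i)))) (Σℚ n (λ i → g (suc m ℕ.+ toℕ i)))))

Σ-1 : ∀ n → Σℚ n (λ _ → 1ℚ) ≡ ι n
Σ-1 zero    = refl
Σ-1 (suc n) = cong (λ z → 1ℚ + z) (Σ-1 n)

[s+t]/s : ∀ s t → (suc s ℕ.+ t) ℕ./ suc s ≡ suc (t ℕ./ suc s)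
[s+t]/s s t = trans (ℕ.m/n≡1+[m∸n]/n {suc s ℕ.+ t} {suc s} (ℕ.m≤m+n (suc s) t))
  (cong (λ z → suc (z ℕ./ suc s)) (ℕ.m+n∸m≡n (suc s) t))

-- Removing the first block lowers every remaining quotient by one. The size `n` enters through an
-- equation because `h * w` must be read as `w * h` for row bundles.
block-count : ∀ {n} m s → n ≡ m ℕ.* suc s → ∀ p → p ℕ.< m →
              Σℚ n (λ j → χ (toℕ j ℕ./ suc s ≡ᵇ p)) ≡ ι (suc s)
block-count (suc m) s refl p p<m = begin
  Σℚ (suc s ℕ.+ m ℕ.* suc s) (λ j → χ (toℕ j ℕ./ suc s ≡ᵇ p))
    ≡⟨ Σ-splitAt (suc s) (m ℕ.* suc s) (λ t → χ (t ℕ./ suc s ≡ᵇ p)) ⟩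
  Σℚ (suc s) (λ j → χ (toℕ j ℕ./ suc s ≡ᵇ p)) + Σℚ (m ℕ.* suc s) (λ j → χ ((suc s ℕ.+ toℕ j) ℕ./ suc s ≡ᵇ p))
    ≡⟨ cong₂ _+_
         (Σ-cong (suc s) (λ j → cong (λ t → χ (t ≡ᵇ p)) (ℕ.m<n⇒m/n≡0 (toℕ<n j))))
         (Σ-cong (m ℕ.* suc s) (λ j → cong (λ t → χ (t ≡ᵇ p)) ([s+t]/s s (toℕ j)))) ⟩
  Σℚ (suc s) (λ _ → χ (0 ≡ᵇ p)) + Σℚ (m ℕ.* suc s) (λ j → χ (suc (toℕ j ℕ./ suc s) ≡ᵇ p))
    ≡⟨ split p p<m ⟩
  ι (suc s) ∎
  where
  open ≡-Reasoning
  split : ∀ p → p ℕ.< suc m → Σℚ (suc s) (λ _ → χ (0 ≡ᵇ p)) + Σℚ (m ℕ.* suc s) (λ j → χ (suc (toℕ j ℕ./ suc s) ≡ᵇ p)) ≡ ι (suc s)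
  split zero    _ = trans (cong₂ _+_ (Σ-1 (suc s)) (Σ-0 (m ℕ.* suc s))) (+-identityʳ (ι (suc s)))
  split (suc p) (ℕ.s≤s p<m) = trans (cong₂ _+_ (Σ-0 (suc s)) (block-count m s refl p p<m)) (+-identityˡ (ι (suc s)))

-- Uniqueness of quotient and remainder modulo `suc h`: a box number determines its row bundle and
-- its column bundle.
base-≡ᵇ : ∀ h p q p′ q′ → q ℕ.< suc h → q′ ℕ.< suc h →
          (suc h ℕ.* p ℕ.+ q ≡ᵇ suc h ℕ.* p′ ℕ.+ q′) ≡ (p ≡ᵇ p′) ∧ (q ≡ᵇ q′)
base-≡ᵇ h p q p′ q′ q<h q′<h with p ℕ.≟ p′ | q ℕ.≟ q′
... | yes refl | yes refl = trans (≡ᵇ-refl (suc h ℕ.* p ℕ.+ q)) (sym (cong₂ _∧_ (≡ᵇ-refl p) (≡ᵇ-refl q)))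
... | yes refl | no q≢q′  = trans (≢⇒≡ᵇ-false (suc h ℕ.* p ℕ.+ q) (suc h ℕ.* p′ ℕ.+ q′) (λ e → q≢q′ (ℕ.+-cancelˡ-≡ (suc h ℕ.* p) q q′ e)))
  (sym (cong₂ _∧_ (≡ᵇ-refl p) (≢⇒≡ᵇ-false q q′ q≢q′)))
... | no p≢p′  | _        = trans (≢⇒≡ᵇ-false (suc h ℕ.* p ℕ.+ q) (suc h ℕ.* p′ ℕ.+ q′) (λ e → p≢p′ (trans (sym (quotient p q q<h)) (trans (cong (ℕ._/ suc h) e) (quotient p′ q′ q′<h)))))
  (sym (cong (_∧ (q ≡ᵇ q′)) (≢⇒≡ᵇ-false p p′ p≢p′)))
  where
  quotient : ∀ p q → q ℕ.< suc h → (suc h ℕ.* p ℕ.+ q) ℕ./ suc h ≡ p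
  quotient p q q<h = trans (ℕ.+-distrib-/-∣ˡ q (ℕ.m∣m*n {suc h} p))
    (trans (cong₂ ℕ._+_ (trans (cong (ℕ._/ suc h) (ℕ.*-comm (suc h) p)) (ℕ.m*n/n≡m p (suc h))) (ℕ.m<n⇒m/n≡0 q<h)) (ℕ.+-identityʳ p))

Σχ≤anyF : ∀ n (p : Fin n → Bool) → (∀ i j → p i ≡ true → p j ≡ true → i ≡ j) → Σℚ n (λ i → χ (p i)) ≤ χ (anyF n p)
Σχ≤anyF zero    p unique = ≤-refl
Σχ≤anyF (suc n) p unique with p zero in e
... | true  = ≤-reflexive (trans (cong (λ z → 1ℚ + z)
                (trans (Σ-cong n (λ i → cong χ (¬p i))) (Σ-0 n))) (+-identityʳ 1ℚ))
  where
  ¬p : ∀ i → p (suc i) ≡ false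
  ¬p i with p (suc i) in e′
  ... | true  = contradiction (unique zero (suc i) e e′) λ ()
  ... | false = refl
... | false = subst (_≤ χ (anyF n (p ∘ suc))) (sym (+-identityˡ (Σℚ n (λ i → χ (p (suc i))))))
                (Σχ≤anyF n (p ∘ suc) (λ i j pi pj → suc-injective (unique (suc i) (suc j) pi pj)))

module _ (h′ w′ : ℕ) where

  private
    h w n : ℕ
    h = suc h′
    w = suc w′
    n = h ℕ.* w

  rowBundle colBundle : Fin n → ℕ
  rowBundle i = toℕ i ℕ./ h
  colBundle j = toℕ j ℕ./ w

  rowBundle<w : ∀ i → rowBundle i ℕ.< w
  rowBundle<w i = ℕ.m<n*o⇒m/o<n (subst (toℕ i ℕ.<_) (ℕ.*-comm h w) (toℕ<n i))

  colBundle<h : ∀ j → colBundle j ℕ.< h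
  colBundle<h j = ℕ.m<n*o⇒m/o<n (toℕ<n j)

  box-≡ᵇ : ∀ i j i′ j′ → (box h w (toℕ i) (toℕ j) ≡ᵇ box h w (toℕ i′) (toℕ j′)) ≡
           (rowBundle i ≡ᵇ rowBundle i′) ∧ (colBundle j ≡ᵇ colBundle j′)
  box-≡ᵇ i j i′ j′ = base-≡ᵇ h′ (rowBundle i) (colBundle j) (rowBundle i′) (colBundle j′) (colBundle<h j) (colBundle<h j′)

  box<n : ∀ i j → box h w (toℕ i) (toℕ j) ℕ.< n
  box<n i j = ℕ.≤-trans (ℕ.+-monoʳ-< (h ℕ.* rowBundle i) (colBundle<h j))
    (subst (ℕ._≤ n) (trans (ℕ.*-suc h (rowBundle i)) (ℕ.+-comm h (h ℕ.* rowBundle i))) (ℕ.*-monoʳ-≤ h (rowBundle<w i)))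

  -- The box with number ℓ meets row ℓ, since ℓ / h is its row bundle.
  box-column : Fin n → Fin n
  box-column ℓ = fromℕ< {(toℕ ℓ ℕ.% h) ℕ.* w} (ℕ.*-monoˡ-< w (ℕ.m%n<n (toℕ ℓ) h))

  box-of-ℓ : ∀ ℓ → toℕ ℓ ≡ box h w (toℕ ℓ) (toℕ (box-column ℓ))
  box-of-ℓ ℓ = begin
    toℕ ℓ                                                ≡⟨ ℕ.m≡m%n+[m/n]*n (toℕ ℓ) h ⟩
    toℕ ℓ ℕ.% h ℕ.+ rowBundle ℓ ℕ.* h                    ≡⟨ ℕ.+-comm (toℕ ℓ ℕ.% h) (rowBundle ℓ ℕ.* h) ⟩
    rowBundle ℓ ℕ.* h ℕ.+ toℕ ℓ ℕ.% h                    ≡⟨ cong₂ ℕ._+_ (ℕ.*-comm (rowBundle ℓ) h) (sym (trans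
                                                              (cong (ℕ._/ w) (toℕ-fromℕ< (ℕ.*-monoˡ-< w (ℕ.m%n<n (toℕ ℓ) h))))
                                                              (ℕ.m*n/n≡m (toℕ ℓ ℕ.% h) w))) ⟩
    h ℕ.* rowBundle ℓ ℕ.+ colBundle (box-column ℓ)       ∎
    where open ≡-Reasoning

  -- The four averaging operators of a Sudoku

  ρₕ ρᵥ ρₙ : ℚ
  ρₕ = proj₁ (ι-reciprocal h′)
  ρᵥ = proj₁ (ι-reciprocal w′)
  ρₙ = ρₕ * ρᵥ

  0≤ρₕ = proj₁ (proj₂ (ι-reciprocal h′))
  0≤ρᵥ = proj₁ (proj₂ (ι-reciprocal w′))
  ρₕ*h≡1 = proj₂ (proj₂ (ι-reciprocal h′))
  ρᵥ*w≡1 = proj₂ (proj₂ (ι-reciprocal w′))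

  0≤ρₙ : 0ℚ ≤ ρₙ
  0≤ρₙ = 0≤* 0≤ρₕ 0≤ρᵥ

  ρₙ*n≡1 : ρₙ * ι n ≡ 1ℚ
  ρₙ*n≡1 = trans (cong (ρₙ *_) (ι-* h w)) (trans
    (solve 4 (λ a b c d → (a :* b) :* (c :* d) := (a :* c) :* (b :* d)) refl ρₕ ρᵥ (ι h) (ι w))
    (cong₂ _*_ ρₕ*h≡1 ρᵥ*w≡1))

  J R C : Op (Fin n)
  J = mean ρₙ all
  R = mean ρₕ rowBundle
  C = mean ρᵥ colBundle

  J-averaging : Averaging (Σℚ n) J
  J-averaging = mean-averaging ρₙ all 0≤ρₙ λ i → trans (cong (ρₙ *_) (Σ-1 n)) ρₙ*n≡1

  R-averaging : Averaging (Σℚ n) R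
  R-averaging = mean-averaging ρₕ rowBundle 0≤ρₕ λ i →
    trans (cong (ρₕ *_) (block-count w h′ (ℕ.*-comm h w) (rowBundle i) (rowBundle<w i))) ρₕ*h≡1

  C-averaging : Averaging (Σℚ n) C
  C-averaging = mean-averaging ρᵥ colBundle 0≤ρᵥ λ j →
    trans (cong (ρᵥ *_) (block-count h w′ refl (colBundle j) (colBundle<h j))) ρᵥ*w≡1

  -- A box is the product of a row bundle and a column bundle, so its average is the composite of
  -- two commuting one-coordinate means.
  boxMean : Op (Triple n)
  boxMean f = lift₁ n R (lift₂ n C f)

  -- In order: the constraints on cells, on a symbol in a row, in a column, and in a box.
  P̂ : Fin 4 → Op (Triple n)
  P̂ 0F = lift₃ n J
  P̂ 1F = lift₂ n J
  P̂ 2F = lift₁ n J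
  P̂ 3F = boxMean

  RC-comm : ∀ f → lift₁ n R (lift₂ n C f) ≗ lift₂ n C (lift₁ n R f)
  RC-comm f (i , j , k) = mean-commute ρᵥ colBundle (linear R-averaging) (λ i′ j′ → f (i′ , j′ , k)) i j

  P̂-averaging : ∀ t → Averaging (Σ³ n) (P̂ t)
  P̂-averaging 0F = lift₃-averaging n J-averaging
  P̂-averaging 1F = lift₂-averaging n J-averaging
  P̂-averaging 2F = lift₁-averaging n J-averaging
  P̂-averaging 3F = ∘-averaging (lift₁-averaging n R-averaging) (lift₂-averaging n C-averaging) RC-comm (Σ³-cong n)

  -- Means in different coordinates commute by linearity. Boxes share a coordinate with rows and
  -- with columns; there both composites reduce to the mean over the whole coordinate, which is
  -- `comm-J`.
  P̂-comm< : (∀ f → P̂ 1F (P̂ 0F f) ≗ P̂ 0F (P̂ 1F f)) × (∀ f → P̂ 2F (P̂ 0F f) ≗ P̂ 0F (P̂ 2F f)) ×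
            (∀ f → P̂ 2F (P̂ 1F f) ≗ P̂ 1F (P̂ 2F f)) × (∀ f → P̂ 3F (P̂ 0F f) ≗ P̂ 0F (P̂ 3F f)) ×
            (∀ f → P̂ 3F (P̂ 1F f) ≗ P̂ 1F (P̂ 3F f)) × (∀ f → P̂ 3F (P̂ 2F f) ≗ P̂ 2F (P̂ 3F f))
  P̂-comm< =
      (λ { f (i , j , k) → mean-commute ρₙ all (linear J-averaging) (λ j′ k′ → f (i , j′ , k′)) j k })
    , (λ { f (i , j , k) → mean-commute ρₙ all (linear J-averaging) (λ i′ k′ → f (i′ , j , k′)) i k })
    , (λ { f (i , j , k) → mean-commute ρₙ all (linear J-averaging) (λ i′ j′ → f (i′ , j′ , k)) i j })
    , (λ { f (i , j , k) → trans
        (≗-cong (linear R-averaging) (λ i′ → mean-commute ρₙ all (linear C-averaging) (λ j′ k′ → f (i′ , j′ , k′)) j k) i)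
        (mean-commute ρₙ all (linear R-averaging) (λ i′ k′ → C (λ j′ → f (i′ , j′ , k′)) j) i k) })
    , (λ { f (i , j , k) → trans
        (≗-cong (linear R-averaging) (λ i′ → comm-J C-averaging (λ j′ → f (i′ , j′ , k)) j) i)
        (mean-commute ρₙ all (linear R-averaging) (λ i′ j″ → C (λ j′ → f (i′ , j′ , k)) j″) i j) })
    , (λ { f (i , j , k) → trans
        (≗-cong (linear R-averaging) (λ i′ → sym (mean-commute ρᵥ colBundle (linear J-averaging) (λ i″ j′ → f (i″ , j′ , k)) i′ j)) i)
        (comm-J R-averaging (λ i′ → C (λ j′ → f (i′ , j′ , k)) j) i) })
    where
    comm-J : ∀ {A} → Averaging (Σℚ n) A → ∀ f → A (J f) ≗ J (A f)
    -- `J f` is constant by computation, since `all` has one class; hence `const` applies to it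
    -- directly.
    comm-J avA f i = trans (const avA (J f i) i) (sym (mean-all-absorbs ρₙ avA f i))

  P̂-comm : ∀ {s t} → s ≢ t → ∀ f → P̂ s (P̂ t f) ≗ P̂ t (P̂ s f)
  P̂-comm {s} {t} _ = comm s t
    where
    c = P̂-comm<
    comm : ∀ s t f → P̂ s (P̂ t f) ≗ P̂ t (P̂ s f)
    comm 0F 0F f x = refl
    comm 1F 1F f x = refl
    comm 2F 2F f x = refl
    comm 3F 3F f x = refl
    comm 1F 0F f x = proj₁ c f x
    comm 2F 0F f x = proj₁ (proj₂ c) f x
    comm 2F 1F f x = proj₁ (proj₂ (proj₂ c)) f x
    comm 3F 0F f x = proj₁ (proj₂ (proj₂ (proj₂ c))) f x
    comm 3F 1F f x = proj₁ (proj₂ (proj₂ (proj₂ (proj₂ c)))) f x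
    comm 3F 2F f x = proj₂ (proj₂ (proj₂ (proj₂ (proj₂ c)))) f x
    comm 0F 1F f x = sym (proj₁ c f x)
    comm 0F 2F f x = sym (proj₁ (proj₂ c) f x)
    comm 1F 2F f x = sym (proj₁ (proj₂ (proj₂ c)) f x)
    comm 0F 3F f x = sym (proj₁ (proj₂ (proj₂ (proj₂ c))) f x)
    comm 1F 3F f x = sym (proj₁ (proj₂ (proj₂ (proj₂ (proj₂ c)))) f x)
    comm 2F 3F f x = sym (proj₂ (proj₂ (proj₂ (proj₂ (proj₂ c)))) f x)

  -- The density hypotheses as bounds on double averages

  module Sudoku {P : Array n} (sudoku : IsPartialSudoku h w P) (dense : IsDense101 h w P) where

    open IsPartialSudoku sudoku
    open IsDense101 dense

    φ : Triple n → ℚ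
    φ (i , j , k) = ι n * χ (P i j k)

    0≤φ : ∀ x → 0ℚ ≤ φ x
    0≤φ (i , j , k) = 0≤* (0≤ι n) (0≤χ (P i j k))

    ρₙφ≡χ : ∀ i j k → ρₙ * φ (i , j , k) ≡ χ (P i j k)
    ρₙφ≡χ i j k = trans (sym (*-assoc ρₙ (ι n) (χ (P i j k))))
      (trans (cong (_* χ (P i j k)) ρₙ*n≡1) (*-identityˡ (χ (P i j k))))

    -- The factor `ι n` in `φ` cancels the 1/n of the mean, so averages of `φ` are counts of filled
    -- triples.
    J-count : ∀ (b : Fin n → Bool) i → J (λ j → ι n * χ (b j)) i ≡ Σℚ n (λ j → χ (b j))
    J-count b i = begin
      J (λ j → ι n * χ (b j)) i                 ≡⟨ mean-all ρₙ (λ j → ι n * χ (b j)) i ⟩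
      ρₙ * Σℚ n (λ j → ι n * χ (b j))           ≡⟨ cong (ρₙ *_) (Σ-* n (ι n) (λ j → χ (b j))) ⟩
      ρₙ * (ι n * Σℚ n (λ j → χ (b j)))         ≡⟨ sym (*-assoc ρₙ (ι n) (Σℚ n (λ j → χ (b j)))) ⟩
      ρₙ * ι n * Σℚ n (λ j → χ (b j))           ≡⟨ cong (_* Σℚ n (λ j → χ (b j))) ρₙ*n≡1 ⟩
      1ℚ * Σℚ n (λ j → χ (b j))                 ≡⟨ *-identityˡ (Σℚ n (λ j → χ (b j))) ⟩
      Σℚ n (λ j → χ (b j))                      ∎
      where open ≡-Reasoning

    N*χ≡0 : ∀ {b} → b ≢ true → ι n * χ b ≡ 0ℚ
    N*χ≡0 {true}  b≢ = contradiction refl b≢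
    N*χ≡0 {false} b≢ = *-zeroʳ (ι n)

    J-isolated : ∀ (b : Fin n → Bool) i → b i ≡ true → (∀ j → b j ≡ true → j ≡ i) → J (λ j → ι n * χ (b j)) i ≡ 1ℚ
    J-isolated b i bi unique = trans (mean-isolated ρₙ all (λ j → ι n * χ (b j)) i (λ j j≢i _ → N*χ≡0 (λ bj → j≢i (unique j bj))))
      (trans (cong (λ z → ρₙ * (ι n * χ z)) bi) (trans (cong (ρₙ *_) (*-identityʳ (ι n))) ρₙ*n≡1))

    P̂φ≡1 : ∀ t i j k → P i j k ≡ true → P̂ t φ (i , j , k) ≡ 1ℚ
    P̂φ≡1 0F i j k Pijk = J-isolated (λ k′ → P i j k′) k Pijk (λ k′ e → cell i j k′ k e Pijk)
    P̂φ≡1 1F i j k Pijk = J-isolated (λ j′ → P i j′ k) j Pijk (λ j′ e → row i j′ j k e Pijk)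
    P̂φ≡1 2F i j k Pijk = J-isolated (λ i′ → P i′ j k) i Pijk (λ i′ e → column i′ i j k e Pijk)
    P̂φ≡1 3F i j k Pijk = begin
      R (λ i′ → C (λ j′ → φ (i′ , j′ , k)) j) i    ≡⟨ mean-isolated ρₕ rowBundle (λ i′ → C (λ j′ → φ (i′ , j′ , k)) j) i (λ i′ i′≢i i′~i →
                                                        trans (C-empty i′ (λ j′ j′~j e → i′≢i (proj₁ (boxes i′ j′ i j k (same-box i′~i j′~j) e Pijk)))) (*-zeroʳ ρᵥ)) ⟩
      ρₕ * C (λ j′ → φ (i , j′ , k)) j             ≡⟨ cong (ρₕ *_) (mean-isolated ρᵥ colBundle (λ j′ → φ (i , j′ , k)) j (λ j′ j′≢j j′~j →
                                                        N*χ≡0 (λ e → j′≢j (proj₂ (boxes i j′ i j k (same-box refl j′~j) e Pijk))))) ⟩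
      ρₕ * (ρᵥ * φ (i , j , k))                    ≡⟨ sym (*-assoc ρₕ ρᵥ (φ (i , j , k))) ⟩
      ρₙ * φ (i , j , k)                           ≡⟨ ρₙφ≡χ i j k ⟩
      χ (P i j k)                                  ≡⟨ cong χ Pijk ⟩
      1ℚ                                           ∎
      where
      open ≡-Reasoning
      same-box = cong₂ (λ p q → h ℕ.* p ℕ.+ q)
      C-empty : ∀ i′ → (∀ j′ → colBundle j′ ≡ colBundle j → P i′ j′ k ≢ true) → C (λ j′ → φ (i′ , j′ , k)) j ≡ ρᵥ * 0ℚ
      C-empty i′ empty = cong (ρᵥ *_) (trans
        (Σ-cong n (λ j′ → trans
          (χ-*-cong (colBundle j′ ≡ᵇ colBundle j) {φ (i′ , j′ , k)} {0ℚ} (λ e → N*χ≡0 (empty j′ (≡ᵇ-true (colBundle j′) (colBundle j) e))))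
          (*-zeroʳ (χ (colBundle j′ ≡ᵇ colBundle j)))))
        (Σ-0 n))

    φ-absorbs : ∀ t x → P̂ t φ x * φ x ≡ φ x
    φ-absorbs t (i , j , k) with P i j k in e
    ... | true  = trans (cong (_* (ι n * 1ℚ)) (P̂φ≡1 t i j k e)) (*-identityˡ (ι n * 1ℚ))
    ... | false = begin
      P̂ t φ (i , j , k) * (ι n * 0ℚ)   ≡⟨ cong (P̂ t φ (i , j , k) *_) (*-zeroʳ (ι n)) ⟩
      P̂ t φ (i , j , k) * 0ℚ           ≡⟨ *-zeroʳ (P̂ t φ (i , j , k)) ⟩
      0ℚ                               ≡⟨ sym (*-zeroʳ (ι n)) ⟩
      ι n * 0ℚ                         ∎
      where open ≡-Reasoning

    filledχ : Triple n → ℚ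
    filledχ (i , j , k) = χ (filled P i j)

    -- The average over a cell counts its symbols, of which there is at most one. This passes from
    -- triples to filled cells, in which the row, column and box densities are expressed.
    P̂₀φ≤filled : ∀ x → P̂ 0F φ x ≤ filledχ x
    P̂₀φ≤filled (i , j , k) = subst (_≤ χ (filled P i j)) (sym (J-count (P i j) k))
      (Σχ≤anyF n (P i j) (λ k k′ → cell i j k k′))

    J-all : ∀ (b : Fin n → Bool) i → J (λ j → χ (b j)) i ≡ ρₙ * ι (count n b)
    J-all b i = trans (mean-all ρₙ (λ j → χ (b j)) i) (cong (ρₙ *_) (sym (ι-count n b)))

    rowFilled : ∀ x → P̂ 1F (P̂ 0F φ) x ≤ ε
    rowFilled (i , j , k) = ≤-trans (mono (P̂-averaging 1F) P̂₀φ≤filled (i , j , k))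
      (subst (_≤ ε) (sym (J-all (λ j → filled P i j) j)) (density (count n (λ j → filled P i j)) 0≤ρₙ ρₙ*n≡1 (rowD i)))

    columnFilled : ∀ x → P̂ 2F (P̂ 0F φ) x ≤ ε
    columnFilled (i , j , k) = ≤-trans (mono (P̂-averaging 2F) P̂₀φ≤filled (i , j , k))
      (subst (_≤ ε) (sym (J-all (λ i → filled P i j) i)) (density (count n (λ i → filled P i j)) 0≤ρₙ ρₙ*n≡1 (colD j)))

    ι-count² : ∀ (b : Fin n → Fin n → Bool) → ι (Σℕ n (λ i → count n (b i))) ≡ Σℚ n (λ i → Σℚ n (λ j → χ (b i j)))
    ι-count² b = trans (ι-Σ n (λ i → count n (b i))) (Σ-cong n (λ i → ι-count n (b i)))

    -- Links the composite of bundle means to the sum over a numbered box. The number `ℓ` is kept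
    -- free, so that it may also be the value of an index in `Fin n`, as in the box density and in
    -- the box sums of a completion.
    boxMean-sum : ∀ (F : Triple n → ℚ) i j k (ℓ : ℕ) → ℓ ≡ box h w (toℕ i) (toℕ j) →
      boxMean F (i , j , k) ≡ Σℚ n (λ i′ → Σℚ n (λ j′ → χ (box h w (toℕ i′) (toℕ j′) ≡ᵇ ℓ) * (ρₙ * F (i′ , j′ , k))))
    boxMean-sum F i j k ℓ refl = begin
      ρₕ * Σℚ n (λ i′ → r i′ * (ρᵥ * Σℚ n (λ j′ → c j′ * F (i′ , j′ , k))))    ≡⟨ sym (Σ-* n ρₕ (λ i′ → r i′ * (ρᵥ * Σℚ n (λ j′ → c j′ * F (i′ , j′ , k))))) ⟩
      Σℚ n (λ i′ → ρₕ * (r i′ * (ρᵥ * Σℚ n (λ j′ → c j′ * F (i′ , j′ , k)))))  ≡⟨ Σ-cong n (λ i′ → inner i′) ⟩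
      Σℚ n (λ i′ → Σℚ n (λ j′ → χ (box h w (toℕ i′) (toℕ j′) ≡ᵇ box h w (toℕ i) (toℕ j)) * (ρₙ * F (i′ , j′ , k)))) ∎
      where
      open ≡-Reasoning
      r c : Fin n → ℚ
      r i′ = χ (rowBundle i′ ≡ᵇ rowBundle i)
      c j′ = χ (colBundle j′ ≡ᵇ colBundle j)
      inner : ∀ i′ → ρₕ * (r i′ * (ρᵥ * Σℚ n (λ j′ → c j′ * F (i′ , j′ , k)))) ≡
              Σℚ n (λ j′ → χ (box h w (toℕ i′) (toℕ j′) ≡ᵇ box h w (toℕ i) (toℕ j)) * (ρₙ * F (i′ , j′ , k)))
      inner i′ = begin
        ρₕ * (r i′ * (ρᵥ * s))                                 ≡⟨ solve 4 (λ a b c d → a :* (b :* (c :* d)) := (a :* (b :* c)) :* d) refl ρₕ (r i′) ρᵥ s ⟩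
        ρₕ * (r i′ * ρᵥ) * s                                   ≡⟨ sym (Σ-* n (ρₕ * (r i′ * ρᵥ)) (λ j′ → c j′ * F (i′ , j′ , k))) ⟩
        Σℚ n (λ j′ → ρₕ * (r i′ * ρᵥ) * (c j′ * F (i′ , j′ , k))) ≡⟨ Σ-cong n (λ j′ → trans
            (solve 5 (λ a b c d e → (a :* (b :* c)) :* (d :* e) := (b :* d) :* ((a :* c) :* e)) refl ρₕ (r i′) ρᵥ (c j′) (F (i′ , j′ , k)))
            (cong (_* (ρₙ * F (i′ , j′ , k))) (sym (trans (cong χ (box-≡ᵇ i′ j′ i j))
              (χ-∧ (rowBundle i′ ≡ᵇ rowBundle i) (colBundle j′ ≡ᵇ colBundle j)))))) ⟩
        Σℚ n (λ j′ → χ (box h w (toℕ i′) (toℕ j′) ≡ᵇ box h w (toℕ i) (toℕ j)) * (ρₙ * F (i′ , j′ , k))) ∎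
        where s = Σℚ n (λ j′ → c j′ * F (i′ , j′ , k))

    boxFilled : ∀ x → P̂ 3F (P̂ 0F φ) x ≤ ε
    boxFilled (i , j , k) = ≤-trans (mono (P̂-averaging 3F) P̂₀φ≤filled (i , j , k))
      (subst (_≤ ε) (sym sum) (density (Σℕ n (λ i′ → count n (λ j′ → b i′ j′ ∧ filled P i′ j′))) 0≤ρₙ ρₙ*n≡1 (boxD ℓ)))
      where
      open ≡-Reasoning
      ℓ = fromℕ< (box<n i j)
      b : Fin n → Fin n → Bool
      b i′ j′ = box h w (toℕ i′) (toℕ j′) ≡ᵇ toℕ ℓ
      sum : boxMean filledχ (i , j , k) ≡ ρₙ * ι (Σℕ n (λ i′ → count n (λ j′ → b i′ j′ ∧ filled P i′ j′)))
      sum = begin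
        boxMean filledχ (i , j , k)                                                ≡⟨ boxMean-sum filledχ i j k (toℕ ℓ) (toℕ-fromℕ< (box<n i j)) ⟩
        Σℚ n (λ i′ → Σℚ n (λ j′ → χ (b i′ j′) * (ρₙ * χ (filled P i′ j′))))        ≡⟨ Σ-cong n (λ i′ → trans (Σ-cong n (λ j′ → trans
            (solve 3 (λ a r c → a :* (r :* c) := r :* (a :* c)) refl (χ (b i′ j′)) ρₙ (χ (filled P i′ j′)))
            (cong (ρₙ *_) (sym (χ-∧ (b i′ j′) (filled P i′ j′))))))
            (Σ-* n ρₙ (λ j′ → χ (b i′ j′ ∧ filled P i′ j′)))) ⟩
        Σℚ n (λ i′ → ρₙ * Σℚ n (λ j′ → χ (b i′ j′ ∧ filled P i′ j′)))              ≡⟨ Σ-* n ρₙ (λ i′ → Σℚ n (λ j′ → χ (b i′ j′ ∧ filled P i′ j′))) ⟩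
        ρₙ * Σℚ n (λ i′ → Σℚ n (λ j′ → χ (b i′ j′ ∧ filled P i′ j′)))              ≡⟨ cong (ρₙ *_) (sym (ι-count² (λ i′ j′ → b i′ j′ ∧ filled P i′ j′))) ⟩
        ρₙ * ι (Σℕ n (λ i′ → count n (λ j′ → b i′ j′ ∧ filled P i′ j′)))           ∎

    -- `J` uses up the factor `ι n` and leaves the count of symbol `k` in a row; `R` then divides
    -- the count over the row bundle by `h`, exactly the scale of the bundle hypothesis.
    RJφ≤ε : ∀ i j k → R (λ i′ → J (λ j′ → φ (i′ , j′ , k)) j) i ≤ ε
    RJφ≤ε i j k = subst (_≤ ε) (sym sum) (density (Σℕ n (λ i′ → count n (λ j′ → b i′ ∧ P i′ j′ k))) 0≤ρₕ ρₕ*h≡1 (rowBundleD (rowBundle i) (rowBundle<w i) k))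
      where
      open ≡-Reasoning
      b : Fin n → Bool
      b i′ = rowBundle i′ ≡ᵇ rowBundle i
      sum : R (λ i′ → J (λ j′ → φ (i′ , j′ , k)) j) i ≡ ρₕ * ι (Σℕ n (λ i′ → count n (λ j′ → b i′ ∧ P i′ j′ k)))
      sum = cong (ρₕ *_) (trans
        (Σ-cong n (λ i′ → trans (cong (χ (b i′) *_) (J-count (λ j′ → P i′ j′ k) j))
          (trans (sym (Σ-* n (χ (b i′)) (λ j′ → χ (P i′ j′ k)))) (Σ-cong n (λ j′ → sym (χ-∧ (b i′) (P i′ j′ k)))))))
        (sym (ι-count² (λ i′ j′ → b i′ ∧ P i′ j′ k))))

    JCφ≤ε : ∀ i j k → J (λ i′ → C (λ j′ → φ (i′ , j′ , k)) j) i ≤ ε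
    JCφ≤ε i j k = subst (_≤ ε) (sym sum) (density (Σℕ n (λ i′ → count n (λ j′ → b j′ ∧ P i′ j′ k))) 0≤ρᵥ ρᵥ*w≡1 (colBundleD (colBundle j) (colBundle<h j) k))
      where
      open ≡-Reasoning
      b : Fin n → Bool
      b j′ = colBundle j′ ≡ᵇ colBundle j
      sum : J (λ i′ → C (λ j′ → φ (i′ , j′ , k)) j) i ≡ ρᵥ * ι (Σℕ n (λ i′ → count n (λ j′ → b j′ ∧ P i′ j′ k)))
      sum = begin
        -- The means are exchanged so that `J` meets `φ` first and cancels its factor `ι n`.
        J (λ i′ → C (λ j′ → φ (i′ , j′ , k)) j) i                               ≡⟨ mean-commute ρᵥ colBundle (linear J-averaging) (λ i′ j′ → φ (i′ , j′ , k)) i j ⟩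
        C (λ j′ → J (λ i′ → φ (i′ , j′ , k)) i) j                               ≡⟨ cong (ρᵥ *_) (Σ-cong n (λ j′ → trans
            (cong (χ (b j′) *_) (J-count (λ i′ → P i′ j′ k) i))
            (trans (sym (Σ-* n (χ (b j′)) (λ i′ → χ (P i′ j′ k)))) (Σ-cong n (λ i′ → sym (χ-∧ (b j′) (P i′ j′ k))))))) ⟩
        ρᵥ * Σℚ n (λ j′ → Σℚ n (λ i′ → χ (b j′ ∧ P i′ j′ k)))                   ≡⟨ cong (ρᵥ *_) (Σ-swap n n (λ j′ i′ → χ (b j′ ∧ P i′ j′ k))) ⟩
        ρᵥ * Σℚ n (λ i′ → Σℚ n (λ j′ → χ (b j′ ∧ P i′ j′ k)))                   ≡⟨ cong (ρᵥ *_) (sym (ι-count² (λ i′ j′ → b j′ ∧ P i′ j′ k))) ⟩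
        ρᵥ * ι (Σℕ n (λ i′ → count n (λ j′ → b j′ ∧ P i′ j′ k)))                ∎

    -- After averaging over a whole row nothing depends on the column, so of the box mean only the
    -- row-bundle mean survives.
    symbolRowBundle : ∀ x → P̂ 3F (P̂ 1F φ) x ≤ ε
    symbolRowBundle (i , j , k) = subst (_≤ ε)
      (sym (≗-cong (linear R-averaging) (λ i′ → const C-averaging (J (λ j′ → φ (i′ , j′ , k)) j) j) i))
      (RJφ≤ε i j k)

    symbolColumnBundle : ∀ x → P̂ 3F (P̂ 2F φ) x ≤ ε
    symbolColumnBundle (i , j , k) = subst (_≤ ε) (sym (begin
      R (λ i′ → C (λ j′ → J (λ i″ → φ (i″ , j′ , k)) i′) j) i   ≡⟨ ≗-cong (linear R-averaging) (λ i′ → sym (mean-commute ρᵥ colBundle (linear J-averaging) (λ i″ j′ → φ (i″ , j′ , k)) i′ j)) i ⟩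
      R (J (λ i″ → C (λ j′ → φ (i″ , j′ , k)) j)) i             ≡⟨ const R-averaging (J (λ i″ → C (λ j′ → φ (i″ , j′ , k)) j) i) i ⟩
      J (λ i″ → C (λ j′ → φ (i″ , j′ , k)) j) i                 ∎)) (JCφ≤ε i j k)
      where open ≡-Reasoning

    -- The density of a symbol in the whole array is not bounded directly by a hypothesis. It is the
    -- mean over all rows of its row-bundle densities, each at most `ε`.
    symbolTotal : ∀ x → P̂ 2F (P̂ 1F φ) x ≤ ε
    symbolTotal (i , j , k) = subst₂ _≤_
      (mean-all-absorbs ρₙ R-averaging (λ i′ → J (λ j′ → φ (i′ , j′ , k)) j) i) (const J-averaging ε i)
      (mono J-averaging (λ i′ → RJφ≤ε i′ j k) i)

    φ-sparse : ∀ {s t} → s ≢ t → ∀ x → P̂ s (P̂ t φ) x ≤ ε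
    φ-sparse {0F} {0F} s≢t x = contradiction refl s≢t
    φ-sparse {1F} {1F} s≢t x = contradiction refl s≢t
    φ-sparse {2F} {2F} s≢t x = contradiction refl s≢t
    φ-sparse {3F} {3F} s≢t x = contradiction refl s≢t
    φ-sparse {1F} {0F} s≢t x = rowFilled x
    φ-sparse {2F} {0F} s≢t x = columnFilled x
    φ-sparse {2F} {1F} s≢t x = symbolTotal x
    φ-sparse {3F} {0F} s≢t x = boxFilled x
    φ-sparse {3F} {1F} s≢t x = symbolRowBundle x
    φ-sparse {3F} {2F} s≢t x = symbolColumnBundle x
    φ-sparse {0F} {1F} s≢t x = subst (_≤ ε) (P̂-comm {1F} {0F} (λ ()) φ x) (rowFilled x)
    φ-sparse {0F} {2F} s≢t x = subst (_≤ ε) (P̂-comm {2F} {0F} (λ ()) φ x) (columnFilled x)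
    φ-sparse {1F} {2F} s≢t x = subst (_≤ ε) (P̂-comm {2F} {1F} (λ ()) φ x) (symbolTotal x)
    φ-sparse {0F} {3F} s≢t x = subst (_≤ ε) (P̂-comm {3F} {0F} (λ ()) φ x) (boxFilled x)
    φ-sparse {1F} {3F} s≢t x = subst (_≤ ε) (P̂-comm {3F} {1F} (λ ()) φ x) (symbolRowBundle x)
    φ-sparse {2F} {3F} s≢t x = subst (_≤ ε) (P̂-comm {3F} {2F} (λ ()) φ x) (symbolColumnBundle x)

    -- Reading off the fractional completion

    completable : ∃ λ (g : Triple n → ℚ) → (∀ x → 0ℚ ≤ g x) × (∀ t x → P̂ t (λ y → g y + φ y) x ≡ 1ℚ)
    completable = Completion.averages-completable (Σ³-definite n) (enumeration n) P̂-averaging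
      (λ {s} {t} → P̂-comm {s} {t}) 0≤φ φ-absorbs (λ {s} {t} → φ-sparse {s} {t})

    F : Triple n → ℚ
    F x = proj₁ completable x + φ x

    P̂F≡1 : ∀ t x → P̂ t F x ≡ 1ℚ
    P̂F≡1 = proj₂ (proj₂ completable)

    f : Fin n → Fin n → Fin n → ℚ
    f i j k = ρₙ * F (i , j , k)

    0≤f : ∀ i j k → 0ℚ ≤ f i j k
    0≤f i j k = 0≤* 0≤ρₙ (0≤+ (proj₁ (proj₂ completable) (i , j , k)) (0≤φ (i , j , k)))

    J-sum : ∀ g i → J g i ≡ 1ℚ → Σℚ n (λ j → ρₙ * g j) ≡ 1ℚ
    J-sum g i e = trans (Σ-* n ρₙ g) (trans (sym (mean-all ρₙ g i)) e)

    cellSum≡1 : ∀ i j → Σℚ n (λ k → f i j k) ≡ 1ℚ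
    -- `J g` does not depend on the point of evaluation; `i` serves only as some index in the symbol
    -- coordinate. The row and column sums do the same.
    cellSum≡1 i j = J-sum (λ k → F (i , j , k)) i (P̂F≡1 0F (i , j , i))

    f≤1 : ∀ i j k → f i j k ≤ 1ℚ
    f≤1 i j k = subst (f i j k ≤_) (cellSum≡1 i j) (term≤Σ n (0≤f i j) k)

    χ≤f : ∀ i j k → χ (P i j k) ≤ f i j k
    χ≤f i j k = subst (_≤ f i j k) (ρₙφ≡χ i j k) (*-monoˡ 0≤ρₙ
      (subst (_≤ F (i , j , k)) (+-identityˡ (φ (i , j , k))) (+-monoˡ-≤ (φ (i , j , k)) (proj₁ (proj₂ completable) (i , j , k)))))

    χ-* : ∀ b q → (if b then q else 0ℚ) ≡ χ b * q
    χ-* true  q = sym (*-identityˡ q)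
    χ-* false q = sym (*-zeroˡ q)

    fractionalCompletion : FractionalCompletion h w P f
    fractionalCompletion = record
      { nonneg  = 0≤f
      ; le1     = f≤1
      -- At a filled triple the share of `φ` alone is already 1, and the cell sum caps the value at
      -- 1.
      ; extends = λ i j k e → ≤-antisym (f≤1 i j k) (subst (λ b → χ b ≤ f i j k) e (χ≤f i j k))
      ; colSum  = λ j k → J-sum (λ i → F (i , j , k)) j (P̂F≡1 2F (j , j , k))
      ; rowSum  = λ i k → J-sum (λ j → F (i , j , k)) i (P̂F≡1 1F (i , i , k))
      ; cellSum = cellSum≡1
      ; boxSum  = λ ℓ k → trans
          (Σ-cong n λ i → Σ-cong n λ j → χ-* (box h w (toℕ i) (toℕ j) ≡ᵇ toℕ ℓ) (f i j k))
          (trans (sym (boxMean-sum F ℓ (box-column ℓ) k (toℕ ℓ) (box-of-ℓ ℓ))) (P̂F≡1 3F (ℓ , box-column ℓ , k))) }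

theorem1p1 : Σ ℕ (λ h₀ → Σ ℕ (λ w₀ →
    ∀ (h w : ℕ) → 2 ℕ.≤ h → 2 ℕ.≤ w → h₀ ℕ.≤ h → w₀ ℕ.≤ w →
    ∀ (P : Array (h ℕ.* w)) → IsPartialSudoku h w P → IsDense101 h w P →
    Σ (Fin (h ℕ.* w) → Fin (h ℕ.* w) → Fin (h ℕ.* w) → ℚ)
    (λ f → FractionalCompletion h w P f)))
-- All estimates are uniform in `h` and `w`, so 0 serves as both thresholds.
theorem1p1 = 0 , 0 , λ { (suc h′) (suc w′) _ _ _ _ P sudoku dense →
  Sudoku.f h′ w′ sudoku dense , Sudoku.fractionalCompletion h′ w′ sudoku dense }
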